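{- Let $$S(z,q)=\sum_{n=1}^\infty \frac{q^n (q^{n+1};q)_\infty}{(zq^n;q)_\infty (z^{ -1}q^n;q)_\infty}.$$ Then $$(z;q)_\infty (z^{ -1};q)_\infty (q;q)_\infty\, S(z,q)=\sum_{n=0}^\infty\sum_{m=0}^n \left(1-z^{\frac12(n-m)}\right)^2 z^{\frac12(m-n)}\left(\frac{ -4}{n}\right)\left(\frac{12}{m}\right) q^{\frac1{12}\left(\frac{3n^2-m^2}{2}-1\right)}$$ as an identity in $\mathbb{Z}[z,z^{ -1}][[q]]$.
   Context: Notation: $(a;q)_\infty=\prod_{k\ge 0}(1-aq^k)$. $\left(\frac{\cdot}{\cdot}\right)$ is the Kronecker symbol: $\left(\frac{ -4}{n}\right)$ is $1$ if $n\equiv1\pmod 4$, $-1$ if $n\equiv 3\pmod 4$, and $0$ if $n$ is even; $\left(\frac{12}{m}\right)$ is $1$ if $m\equiv\pm1\pmod{12}$, $-1$ if $m\equiv\pm5\pmod{12}$, and $0$ otherwise. Terms in which a Kronecker symbol vanishes are zero; in all other terms $n$ and $m$ are odd and the exponents of $z$ and $q$ are integers. $S(z,q)$ is the generating function of the spt-crank. -}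

module Defs where

open import Level using (0ℓ)
open import Algebra.Bundles using (CommutativeRing)
open import Data.Bool.Base using (true; false; if_then_else_)
open import Data.Integer.Base as ℤ using (ℤ; +_; 0ℤ; 1ℤ; -1ℤ)
import Data.Integer.Properties as ℤₚ
open import Data.Integer.Tactic.RingSolver using (solve-∀)
open import Data.List.Base using (List; []; _∷_; _++_; map; cartesianProductWith)
open import Data.Nat.Base as ℕ using (ℕ; zero; suc; _∸_; _≤_; _<_; z≤n; s≤s)
open import Data.Nat.DivMod using (_/_; _%_; /-monoˡ-≤; m*n/n≡m)
import Data.Nat.Properties as ℕₚ
open import Data.Product.Base using (_×_; _,_; proj₁; ∃-syntax)
open import Data.Vec.Base using (Vec; []; _∷_; head)
open import Function.Base using (_∘_; _$_)
open import Relation.Binary.PropositionalEquality as ≡ using (_≡_; refl; cong; cong₂)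
open import Relation.Nullary.Decidable using (does; yes; no; dec-false)
open import Relation.Nullary.Negation using (contradiction)

module LaurentPolynomial where

  infix  4 _≈_
  infixl 6 _+_
  infixl 7 _*_
  infix  8 -_

  -- The list (e₁ , c₁) ∷ … ∷ (eᵣ , cᵣ) ∷ [] stands for c₁zᵉ¹ + … + cᵣzᵉʳ.
  -- Exponents may repeat and coefficients may vanish, so equality is
  -- equality of all the collected coefficients.
  Laurent : Set
  Laurent = List (ℤ × ℤ)

  coeff : Laurent → ℤ → ℤ
  coeff []            k = 0ℤ
  coeff ((e , c) ∷ p) k = (if does (e ℤₚ.≟ k) then c else 0ℤ) ℤ.+ coeff p k

  record _≈_ (p r : Laurent) : Set where
    constructor mk≈
    field coeff-≡ : ∀ k → coeff p k ≡ coeff r k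
  open _≈_ public

  _+_ : Laurent → Laurent → Laurent
  _+_ = _++_

  -_ : Laurent → Laurent
  -_ = map λ (e , c) → e , ℤ.- c

  _*_ : Laurent → Laurent → Laurent
  _*_ = cartesianProductWith λ (e , c) (e′ , c′) → e ℤ.+ e′ , c ℤ.* c′

  0# 1# : Laurent
  0# = []
  1# = (0ℤ , 1ℤ) ∷ []

  const : ℤ → Laurent
  const c = (0ℤ , c) ∷ []

  z^ : ℤ → Laurent
  z^ k = (k , 1ℤ) ∷ []

  coeff-+ : ∀ p r k → coeff (p + r) k ≡ coeff p k ℤ.+ coeff r k
  coeff-+ []            r k = ≡.sym (ℤₚ.+-identityˡ _)
  coeff-+ ((e , c) ∷ p) r k =
    ≡.trans (cong (ℤ._+_ a) (coeff-+ p r k)) (≡.sym (ℤₚ.+-assoc a (coeff p k) (coeff r k)))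
    where
    a : ℤ
    a = if does (e ℤₚ.≟ k) then c else 0ℤ

  coeff-neg : ∀ p k → coeff (- p) k ≡ ℤ.- coeff p k
  coeff-neg []            k = refl
  coeff-neg ((e , c) ∷ p) k with e ℤₚ.≟ k
  ... | yes _ = ≡.trans (cong (ℤ._+_ (ℤ.- c)) (coeff-neg p k)) (≡.sym (ℤₚ.neg-distrib-+ c (coeff p k)))
  ... | no  _ = ≡.trans (cong (ℤ._+_ 0ℤ) (coeff-neg p k)) (≡.sym (ℤₚ.neg-distrib-+ 0ℤ (coeff p k)))

  -- The coefficients of p * r are obtained from those of r by letting p
  -- act on functions ℤ → ℤ, each monomial acting as a scaled translation.
  act : Laurent → (ℤ → ℤ) → ℤ → ℤ
  act []            g k = 0ℤ
  act ((e , c) ∷ p) g k = c ℤ.* g (k ℤ.- e) ℤ.+ act p g k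

  private
    cancel₁ : ∀ e k → e ℤ.+ (k ℤ.- e) ≡ k
    cancel₁ = solve-∀

    cancel₂ : ∀ e f → (e ℤ.+ f) ℤ.- e ≡ f
    cancel₂ = solve-∀

    shift-indicator : ∀ e e′ c k →
      (if does (e ℤ.+ e′ ℤₚ.≟ k) then c else 0ℤ) ≡ (if does (e′ ℤₚ.≟ k ℤ.- e) then c else 0ℤ)
    shift-indicator e e′ c k with e ℤ.+ e′ ℤₚ.≟ k | e′ ℤₚ.≟ k ℤ.- e
    ... | yes _ | yes _ = refl
    ... | no  _ | no  _ = refl
    ... | yes refl | no ¬q = contradiction (≡.sym (cancel₂ e e′)) ¬q
    ... | no ¬p | yes refl = contradiction (cancel₁ e k) ¬p

    scale-indicator : ∀ b c d → c ℤ.* (if b then d else 0ℤ) ≡ (if b then c ℤ.* d else 0ℤ)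
    scale-indicator true  c d = refl
    scale-indicator false c d = ℤₚ.*-zeroʳ c

    interchange : ∀ a b c d → (a ℤ.+ b) ℤ.+ (c ℤ.+ d) ≡ (a ℤ.+ c) ℤ.+ (b ℤ.+ d)
    interchange = solve-∀

  coeff-monomial-* : ∀ e c r k →
    coeff (map (λ (e′ , c′) → e ℤ.+ e′ , c ℤ.* c′) r) k ≡ c ℤ.* coeff r (k ℤ.- e)
  coeff-monomial-* e c []              k = ≡.sym (ℤₚ.*-zeroʳ c)
  coeff-monomial-* e c ((e′ , c′) ∷ r) k = ≡.trans
    (cong₂ ℤ._+_
      (≡.trans (shift-indicator e e′ (c ℤ.* c′) k)
               (≡.sym (scale-indicator (does (e′ ℤₚ.≟ k ℤ.- e)) c c′)))
      (coeff-monomial-* e c r k))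
    (≡.sym (ℤₚ.*-distribˡ-+ c _ (coeff r (k ℤ.- e))))

  coeff-* : ∀ p r k → coeff (p * r) k ≡ act p (coeff r) k
  coeff-* []            r k = refl
  coeff-* ((e , c) ∷ p) r k = ≡.trans
    (coeff-+ (map _ r) (p * r) k)
    (cong₂ ℤ._+_ (coeff-monomial-* e c r k) (coeff-* p r k))

  act-cong : ∀ p {g h} → (∀ k → g k ≡ h k) → ∀ k → act p g k ≡ act p h k
  act-cong []            g≡h k = refl
  act-cong ((e , c) ∷ p) g≡h k = cong₂ ℤ._+_ (cong (c ℤ.*_) (g≡h _)) (act-cong p g≡h k)

  act-zero : ∀ p k → act p (λ _ → 0ℤ) k ≡ 0ℤ
  act-zero []            k = refl
  act-zero ((e , c) ∷ p) k = cong₂ ℤ._+_ (ℤₚ.*-zeroʳ c) (act-zero p k)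

  act-+ : ∀ p g h k → act p (λ j → g j ℤ.+ h j) k ≡ act p g k ℤ.+ act p h k
  act-+ []            g h k = refl
  act-+ ((e , c) ∷ p) g h k = ≡.trans
    (cong₂ ℤ._+_ (ℤₚ.*-distribˡ-+ c (g _) (h _)) (act-+ p g h k))
    (interchange (c ℤ.* g _) (c ℤ.* h _) (act p g k) (act p h k))

  act-++ : ∀ p r g k → act (p + r) g k ≡ act p g k ℤ.+ act r g k
  act-++ []            r g k = ≡.sym (ℤₚ.+-identityˡ _)
  act-++ ((e , c) ∷ p) r g k =
    ≡.trans (cong (ℤ._+_ a) (act-++ p r g k)) (≡.sym (ℤₚ.+-assoc a (act p g k) (act r g k)))
    where
    a : ℤ
    a = c ℤ.* g (k ℤ.- e)

  act-* : ∀ p r g k → act (p * r) g k ≡ act p (act r g) k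
  act-* []            r g k = refl
  act-* ((e , c) ∷ p) r g k = ≡.trans
    (act-++ (map _ r) (p * r) g k)
    (cong₂ ℤ._+_ (monomial r) (act-* p r g k))
    where
    translate : ∀ k e f → k ℤ.- (e ℤ.+ f) ≡ k ℤ.- e ℤ.- f
    translate = solve-∀

    monomial : ∀ r → act (map (λ (e′ , c′) → e ℤ.+ e′ , c ℤ.* c′) r) g k ≡ c ℤ.* act r g (k ℤ.- e)
    monomial []              = ≡.sym (ℤₚ.*-zeroʳ c)
    monomial ((e′ , c′) ∷ r) = ≡.trans
      (cong₂ ℤ._+_
        (≡.trans (cong (λ j → c ℤ.* c′ ℤ.* g j) (translate k e e′)) (ℤₚ.*-assoc c c′ _))
        (monomial r))
      (≡.sym (ℤₚ.*-distribˡ-+ c _ _))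

  act-monomial : ∀ e c r k →
    act r (λ j → if does (e ℤₚ.≟ j) then c else 0ℤ) k ≡ c ℤ.* coeff r (k ℤ.- e)
  act-monomial e c []              k = ≡.sym (ℤₚ.*-zeroʳ c)
  act-monomial e c ((e′ , c′) ∷ r) k = ≡.trans
    (cong₂ ℤ._+_ summand (act-monomial e c r k))
    (≡.sym (ℤₚ.*-distribˡ-+ c _ (coeff r (k ℤ.- e))))
    where
    open ≡.≡-Reasoning
    summand : c′ ℤ.* (if does (e ℤₚ.≟ k ℤ.- e′) then c else 0ℤ)
            ≡ c ℤ.* (if does (e′ ℤₚ.≟ k ℤ.- e) then c′ else 0ℤ)
    summand = begin
      c′ ℤ.* (if does (e ℤₚ.≟ k ℤ.- e′) then c else 0ℤ)
        ≡⟨ scale-indicator (does (e ℤₚ.≟ k ℤ.- e′)) c′ c ⟩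
      (if does (e ℤₚ.≟ k ℤ.- e′) then c′ ℤ.* c else 0ℤ)
        ≡⟨ shift-indicator e′ e (c′ ℤ.* c) k ⟨
      (if does (e′ ℤ.+ e ℤₚ.≟ k) then c′ ℤ.* c else 0ℤ)
        ≡⟨ cong₂ (λ s d → if does (s ℤₚ.≟ k) then d else 0ℤ) (ℤₚ.+-comm e′ e) (ℤₚ.*-comm c′ c) ⟩
      (if does (e ℤ.+ e′ ℤₚ.≟ k) then c ℤ.* c′ else 0ℤ)
        ≡⟨ shift-indicator e e′ (c ℤ.* c′) k ⟩
      (if does (e′ ℤₚ.≟ k ℤ.- e) then c ℤ.* c′ else 0ℤ)
        ≡⟨ scale-indicator (does (e′ ℤₚ.≟ k ℤ.- e)) c c′ ⟨
      c ℤ.* (if does (e′ ℤₚ.≟ k ℤ.- e) then c′ else 0ℤ) ∎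

  act-comm : ∀ p r k → act p (coeff r) k ≡ act r (coeff p) k
  act-comm []            r k = ≡.sym (act-zero r k)
  act-comm ((e , c) ∷ p) r k = ≡.sym $ ≡.trans
    (act-+ r _ (coeff p) k)
    (cong₂ ℤ._+_ (act-monomial e c r k) (≡.sym (act-comm p r k)))

  +-cong : ∀ {p p′ r r′} → p ≈ p′ → r ≈ r′ → p + r ≈ p′ + r′
  +-cong {p} {p′} {r} {r′} p≈ r≈ .coeff-≡ k = ≡.trans (coeff-+ p r k) $
    ≡.trans (cong₂ ℤ._+_ (p≈ .coeff-≡ k) (r≈ .coeff-≡ k)) (≡.sym (coeff-+ p′ r′ k))

  +-comm : ∀ p r → p + r ≈ r + p
  +-comm p r .coeff-≡ k = ≡.trans (coeff-+ p r k) $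
    ≡.trans (ℤₚ.+-comm (coeff p k) _) (≡.sym (coeff-+ r p k))

  +-assoc : ∀ p r s → (p + r) + s ≈ p + (r + s)
  +-assoc p r s .coeff-≡ k = ≡.trans (≡.trans (coeff-+ (p + r) s k) (cong (ℤ._+ coeff s k) (coeff-+ p r k))) $
    ≡.trans (ℤₚ.+-assoc (coeff p k) _ _) $
    ≡.sym (≡.trans (coeff-+ p (r + s) k) (cong (ℤ._+_ (coeff p k)) (coeff-+ r s k)))

  +-identityʳ : ∀ p → p + 0# ≈ p
  +-identityʳ p .coeff-≡ k = ≡.trans (coeff-+ p 0# k) (ℤₚ.+-identityʳ _)

  -‿cong : ∀ {p r} → p ≈ r → - p ≈ - r
  -‿cong {p} {r} p≈r .coeff-≡ k =
    ≡.trans (coeff-neg p k) (≡.trans (cong ℤ.-_ (p≈r .coeff-≡ k)) (≡.sym (coeff-neg r k)))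

  -‿inverseʳ : ∀ p → p + - p ≈ 0#
  -‿inverseʳ p .coeff-≡ k = ≡.trans (coeff-+ p (- p) k) $
    ≡.trans (cong (ℤ._+_ (coeff p k)) (coeff-neg p k)) (ℤₚ.+-inverseʳ (coeff p k))

  *-comm : ∀ p r → p * r ≈ r * p
  *-comm p r .coeff-≡ k =
    ≡.trans (coeff-* p r k) (≡.trans (act-comm p r k) (≡.sym (coeff-* r p k)))

  *-congˡ : ∀ {p r r′} → r ≈ r′ → p * r ≈ p * r′
  *-congˡ {p} {r} {r′} r≈ .coeff-≡ k =
    ≡.trans (coeff-* p r k) (≡.trans (act-cong p (r≈ .coeff-≡) k) (≡.sym (coeff-* p r′ k)))

  *-assoc : ∀ p r s → (p * r) * s ≈ p * (r * s)
  *-assoc p r s .coeff-≡ k = ≡.trans (coeff-* (p * r) s k) $ ≡.trans (act-* p r (coeff s) k) $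
    ≡.sym (≡.trans (coeff-* p (r * s) k) (act-cong p (coeff-* r s) k))

  *-distribˡ-+ : ∀ p r s → p * (r + s) ≈ p * r + p * s
  *-distribˡ-+ p r s .coeff-≡ k = ≡.trans (coeff-* p (r + s) k) $
    ≡.trans (≡.trans (act-cong p (coeff-+ r s) k) (act-+ p (coeff r) (coeff s) k)) $
    ≡.sym (≡.trans (coeff-+ (p * r) (p * s) k) (cong₂ ℤ._+_ (coeff-* p r k) (coeff-* p s k)))

  *-identityˡ : ∀ p → 1# * p ≈ p
  *-identityˡ p .coeff-≡ k = ≡.trans (coeff-* 1# p k) $
    ≡.trans (ℤₚ.+-identityʳ _) $
    ≡.trans (ℤₚ.*-identityˡ _) (cong (coeff p) (ℤₚ.+-identityʳ k))

  ≈-refl : ∀ {p} → p ≈ p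
  ≈-refl .coeff-≡ _ = refl

  ≈-sym : ∀ {p r} → p ≈ r → r ≈ p
  ≈-sym p≈r .coeff-≡ k = ≡.sym (p≈r .coeff-≡ k)

  ≈-trans : ∀ {p r s} → p ≈ r → r ≈ s → p ≈ s
  ≈-trans p≈r r≈s .coeff-≡ k = ≡.trans (p≈r .coeff-≡ k) (r≈s .coeff-≡ k)

  commutativeRing : CommutativeRing 0ℓ 0ℓ
  commutativeRing = record
    { Carrier = Laurent ; _≈_ = _≈_ ; _+_ = _+_ ; _*_ = _*_ ; -_ = -_ ; 0# = 0# ; 1# = 1#
    ; isCommutativeRing = record
      { isRing = record
        { +-isAbelianGroup = record
          { isGroup = record
            { isMonoid = record
              { isSemigroup = record
                { isMagma = record
                  { isEquivalence = record { refl = ≈-refl ; sym = ≈-sym ; trans = ≈-trans }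
                  ; ∙-cong = +-cong }
                ; assoc = +-assoc }
              ; identity = (λ _ → ≈-refl) , +-identityʳ }
            ; inverse = (λ p → ≈-trans (+-comm (- p) p) (-‿inverseʳ p)) , -‿inverseʳ
            ; ⁻¹-cong = -‿cong }
          ; comm = +-comm }
        ; *-cong = λ {p} {p′} {r} {r′} p≈ r≈ → ≈-trans (*-congˡ {p} r≈)
            (≈-trans (*-comm p r′) (≈-trans (*-congˡ {r′} p≈) (*-comm r′ p′)))
        ; *-assoc = *-assoc
        ; *-identity = *-identityˡ , λ p → ≈-trans (*-comm p 1#) (*-identityˡ p)
        ; distrib = *-distribˡ-+ , λ p r s → ≈-trans (*-comm (r + s) p)
            (≈-trans (*-distribˡ-+ p r s) (+-cong (*-comm p r) (*-comm p s)))
        }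
      ; *-comm = *-comm
      }
    }

module PowerSeries {c ℓ} (R : CommutativeRing c ℓ) where

  private module R = CommutativeRing R
  open R using (Carrier; 0#; 1#)
  open import Algebra.Properties.Ring R.ring using (-0#≈0#)
  open import Relation.Binary.Reasoning.Setoid R.setoid

  infix  4 _≈_
  infixl 6 _+_ _-_
  infixl 7 _*_

  sumBelow : ℕ → (ℕ → Carrier) → Carrier
  sumBelow zero    f = 0#
  sumBelow (suc n) f = sumBelow n f R.+ f n

  Series : Set c
  Series = ℕ → Carrier

  _≈_ : Series → Series → Set ℓ
  f ≈ g = ∀ N → f N R.≈ g N

  monomial : Carrier → ℕ → Series
  monomial a n N = if does (n ℕₚ.≟ N) then a else 0#

  C : Carrier → Series
  C a = monomial a 0

  q^ : ℕ → Series
  q^ = monomial 1#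

  0ₛ 1ₛ : Series
  0ₛ _ = 0#
  1ₛ = C 1#

  _+_ _-_ _*_ : Series → Series → Series
  (f + g) N = f N R.+ g N
  (f - g) N = f N R.+ R.- g N
  (f * g) N = sumBelow (suc N) λ i → f i R.* g (N ∸ i)

  ∑< ∏< : ℕ → (ℕ → Series) → Series
  ∑< zero    f = 0ₛ
  ∑< (suc n) f = ∑< n f + f n
  ∏< zero    f = 1ₛ
  ∏< (suc n) f = ∏< n f * f n

  -- f ∈ qⁿR[[q]]
  O : ℕ → Series → Set ℓ
  O n f = ∀ i → i < n → f i R.≈ 0#

  -- A sequence of series converges q-adically when the coefficient of
  -- each q^N is eventually constant.
  Convergent : (ℕ → Series) → Set ℓ
  Convergent s = ∀ N → ∃[ M ] (∀ n → M ≤ n → s n N R.≈ s M N)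

  lim : (s : ℕ → Series) → Convergent s → Series
  lim s conv N = s (proj₁ (conv N)) N

  Summable Multipliable : (ℕ → Series) → Set ℓ
  Summable     f = Convergent λ n → ∑< n f
  Multipliable f = Convergent λ n → ∏< n f

  ∑∞ : (f : ℕ → Series) → Summable f → Series
  ∑∞ f = lim λ n → ∑< n f

  ∏∞ : (f : ℕ → Series) → Multipliable f → Series
  ∏∞ f = lim λ n → ∏< n f

  sumBelow-zero : ∀ n {f} → (∀ i → i < n → f i R.≈ 0#) → sumBelow n f R.≈ 0#
  sumBelow-zero zero    f≈0 = R.refl
  sumBelow-zero (suc n) f≈0 = R.trans
    (R.+-cong (sumBelow-zero n λ i i<n → f≈0 i (ℕₚ.m<n⇒m<1+n i<n)) (f≈0 n (ℕₚ.n<1+n n)))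
    (R.+-identityˡ 0#)

  sumBelow-head : ∀ n f → sumBelow (suc n) f R.≈ f 0 R.+ sumBelow n (f ∘ suc)
  sumBelow-head zero    f = R.+-comm 0# (f 0)
  sumBelow-head (suc n) f = R.trans (R.+-congʳ (sumBelow-head n f)) (R.+-assoc _ _ _)

  O-monomial : ∀ a n → O n (monomial a n)
  O-monomial a n i i<n rewrite dec-false (n ℕₚ.≟ i) (ℕₚ.>⇒≢ i<n) = R.refl

  O-*ˡ : ∀ {n f} g → O n f → O n (f * g)
  O-*ˡ g Of N N<n = sumBelow-zero (suc N) λ i i≤N →
    R.trans (R.*-congʳ (Of i (ℕₚ.<-≤-trans i≤N N<n))) (R.zeroˡ _)

  O-*ʳ : ∀ {n} f {g} → O n g → O n (f * g)
  O-*ʳ f Og N N<n = sumBelow-zero (suc N) λ i _ →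
    R.trans (R.*-congˡ (Og (N ∸ i) (ℕₚ.≤-<-trans (ℕₚ.m∸n≤m N i) N<n))) (R.zeroʳ _)

  O-∑< : ∀ {n} k {f} → (∀ i → i < k → O n (f i)) → O n (∑< k f)
  O-∑< zero    Of N N<n = R.refl
  O-∑< (suc k) Of N N<n = R.trans
    (R.+-cong (O-∑< k (λ i i<k → Of i (ℕₚ.m<n⇒m<1+n i<k)) N N<n) (Of k (ℕₚ.n<1+n k) N N<n))
    (R.+-identityˡ 0#)

  *-constantTerm : ∀ {f g} → f 0 R.≈ 1# → g 0 R.≈ 1# → (f * g) 0 R.≈ 1#
  *-constantTerm f₀≈1 g₀≈1 =
    R.trans (R.+-identityˡ _) (R.trans (R.*-cong f₀≈1 g₀≈1) (R.*-identityˡ 1#))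

  convergent : ∀ s (M : ℕ → ℕ) → (∀ N n → M N ≤ n → s (suc n) N R.≈ s n N) → Convergent s
  convergent s M step N = M N , λ n M≤n → go (ℕₚ.≤⇒≤′ M≤n)
    where
    go : ∀ {n} → M N ℕ.≤′ n → s n N R.≈ s (M N) N
    go ℕ.≤′-refl       = R.refl
    go (ℕ.≤′-step M≤n) = R.trans (step N _ (ℕₚ.≤′⇒≤ M≤n)) (go M≤n)

  summable : ∀ f (M : ℕ → ℕ) → (∀ N n → M N ≤ n → f n N R.≈ 0#) → Summable f
  summable f M f≈0 = convergent _ M λ N n M≤n →
    R.trans (R.+-congˡ (f≈0 N n M≤n)) (R.+-identityʳ _)

  multipliable : ∀ f → (∀ n i → i < n → f n i R.≈ 1ₛ i) → Multipliable f
  multipliable f f≈1 = convergent _ suc λ N n N<n → begin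
    sumBelow N (λ i → ∏< n f i R.* f n (N ∸ i)) R.+ ∏< n f N R.* f n (N ∸ N)
      ≈⟨ R.+-cong
           (sumBelow-zero N λ i i<N → R.trans (R.*-congˡ (higher N n i N<n i<N)) (R.zeroʳ _))
           (R.*-congˡ (lowest N n N<n)) ⟩
    0# R.+ ∏< n f N R.* 1#
      ≈⟨ R.trans (R.+-identityˡ _) (R.*-identityʳ _) ⟩
    ∏< n f N ∎
    where
    higher : ∀ N n i → N < n → i < N → f n (N ∸ i) R.≈ 0#
    higher N n i N<n i<N = R.trans
      (f≈1 n (N ∸ i) (ℕₚ.≤-<-trans (ℕₚ.m∸n≤m N i) N<n))
      (positive (ℕₚ.m<n⇒0<n∸m i<N))
      where
      positive : ∀ {j} → 0 < j → 1ₛ j R.≈ 0#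
      positive (s≤s _) = R.refl

    lowest : ∀ N n → N < n → f n (N ∸ N) R.≈ 1#
    lowest N n N<n rewrite ℕₚ.n∸n≡0 N = f≈1 n 0 (ℕₚ.≤-<-trans z≤n N<n)

  -- The reciprocal g of a series f with constant term 1 is given by g₀ = 1
  -- and gₙ₊₁ = - (f₁gₙ + f₂gₙ₋₁ + … + fₙ₊₁g₀).
  module _ (f : Series) where

    private
      dot : Series → ∀ {n} → Vec Carrier n → Carrier
      dot h []       = 0#
      dot h (x ∷ xs) = h 0 R.* x R.+ dot (h ∘ suc) xs

      -- gₙ ∷ … ∷ g₀ ∷ []
      initial : ∀ n → Vec Carrier (suc n)
      initial zero    = 1# ∷ []
      initial (suc n) = (R.- dot (f ∘ suc) (initial n)) ∷ initial n

    inv : f 0 R.≈ 1# → Series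
    inv _ n = head (initial n)

    private
      dot-initial : ∀ f₀≈1 n h → dot h (initial n) R.≈ (h * inv f₀≈1) n
      dot-initial f₀≈1 zero    h = R.+-comm _ 0#
      dot-initial f₀≈1 (suc n) h = R.trans
        (R.+-congˡ (dot-initial f₀≈1 n (h ∘ suc)))
        (R.sym (sumBelow-head (suc n) _))

    *-inverseʳ : ∀ f₀≈1 → f * inv f₀≈1 ≈ 1ₛ
    *-inverseʳ f₀≈1 zero    = *-constantTerm {f} {inv f₀≈1} f₀≈1 R.refl
    *-inverseʳ f₀≈1 (suc n) = begin
      (f * inv f₀≈1) (suc n)
        ≈⟨ sumBelow-head (suc n) _ ⟩
      f 0 R.* (R.- dot (f ∘ suc) (initial n)) R.+ ((f ∘ suc) * inv f₀≈1) n
        ≈⟨ R.+-cong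
             (R.trans (R.*-congʳ f₀≈1) (R.*-identityˡ _))
             (R.sym (dot-initial f₀≈1 n (f ∘ suc))) ⟩
      R.- dot (f ∘ suc) (initial n) R.+ dot (f ∘ suc) (initial n)
        ≈⟨ R.-‿inverseˡ _ ⟩
      0# ∎

  pochhammer-multipliable : ∀ a → Multipliable λ k → 1ₛ - a * q^ k
  pochhammer-multipliable a = multipliable _ λ k i i<k → begin
    1ₛ i R.+ R.- (a * q^ k) i ≈⟨ R.+-congˡ (R.-‿cong (O-*ʳ a (O-monomial 1# k) i i<k)) ⟩
    1ₛ i R.+ R.- 0#           ≈⟨ R.+-congˡ -0#≈0# ⟩
    1ₛ i R.+ 0#               ≈⟨ R.+-identityʳ _ ⟩
    1ₛ i                      ∎

  -- (a;q)_∞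
  ⟨_⨾q⟩∞ : Series → Series
  ⟨ a ⨾q⟩∞ = ∏∞ (λ k → 1ₛ - a * q^ k) (pochhammer-multipliable a)

  pochhammer-constantTerm : ∀ a → a 0 R.≈ 0# → ⟨ a ⨾q⟩∞ 0 R.≈ 1#
  pochhammer-constantTerm a a₀≈0 = *-constantTerm {1ₛ} {1ₛ - a * q^ 0} R.refl $ begin
    1# R.+ R.- (0# R.+ a 0 R.* 1#) ≈⟨ R.+-congˡ (R.-‿cong (R.+-identityˡ _)) ⟩
    1# R.+ R.- (a 0 R.* 1#)        ≈⟨ R.+-congˡ (R.-‿cong (R.trans (R.*-identityʳ _) a₀≈0)) ⟩
    1# R.+ R.- 0#                  ≈⟨ R.+-congˡ -0#≈0# ⟩
    1# R.+ 0#                      ≈⟨ R.+-identityʳ 1# ⟩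
    1#                             ∎

module L = LaurentPolynomial
open L using (Laurent; z^)
open PowerSeries L.commutativeRing public

sptDenominator : ℕ → Series
sptDenominator n = ⟨ monomial (z^ 1ℤ) n ⨾q⟩∞ * ⟨ monomial (z^ -1ℤ) n ⨾q⟩∞

sptDenominator-constantTerm : ∀ n → sptDenominator (suc n) 0 L.≈ L.1#
sptDenominator-constantTerm n = *-constantTerm {⟨ zq ⨾q⟩∞} {⟨ z⁻¹q ⨾q⟩∞}
  (pochhammer-constantTerm zq L.≈-refl) (pochhammer-constantTerm z⁻¹q L.≈-refl)
  where
  zq z⁻¹q : Series
  zq   = monomial (z^ 1ℤ) (suc n)
  z⁻¹q = monomial (z^ -1ℤ) (suc n)

-- The summand with summation index suc n, so that indices start from 1.
sptSummand : ℕ → Series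
sptSummand n = q^ (suc n) * (⟨ q^ (suc (suc n)) ⨾q⟩∞ * 1/denominator)
  where
  1/denominator : Series
  1/denominator = inv (sptDenominator (suc n)) (sptDenominator-constantTerm n)

sptSummand-summable : Summable sptSummand
sptSummand-summable = summable sptSummand (λ N → N) λ N n N≤n →
  O-*ˡ {f = q^ (suc n)} (cofactor n) (O-monomial L.1# (suc n)) N (s≤s N≤n)
  where
  cofactor : ℕ → Series
  cofactor n = ⟨ q^ (suc (suc n)) ⨾q⟩∞ * inv (sptDenominator (suc n)) (sptDenominator-constantTerm n)

S : Series
S = ∑∞ sptSummand sptSummand-summable

-- The Kronecker symbols (-4 / n) and (12 / m).
χ₋₄ χ₁₂ : ℕ → ℤ
χ₋₄ n with n % 4
... | 1 = 1ℤ
... | 3 = -1ℤ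
... | _ = 0ℤ
χ₁₂ m with m % 12
... | 1  = 1ℤ
... | 5  = -1ℤ
... | 7  = -1ℤ
... | 11 = 1ℤ
... | _  = 0ℤ

-- For m ≤ n with χ₋₄ n and χ₁₂ m both nonzero, every subtraction and
-- division below is exact.  All other summands with m ≤ n vanish because of
-- their coefficient.
heckeExponent : ℕ → ℕ → ℕ
heckeExponent n m = ((3 ℕ.* (n ℕ.* n) ∸ m ℕ.* m) / 2 ∸ 1) / 12

heckeCoefficient : ℕ → ℕ → Laurent
heckeCoefficient n m =
  (L.1# L.+ L.- z^ (+ h)) L.* (L.1# L.+ L.- z^ (+ h)) L.* z^ (ℤ.- + h)
    L.* L.const (χ₋₄ n) L.* L.const (χ₁₂ m)
  where
  h : ℕ
  h = (n ∸ m) / 2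

heckeSummand : ℕ → ℕ → Series
heckeSummand n m = monomial (heckeCoefficient n m) (heckeExponent n m)

heckeExponent-large : ∀ N n m → suc (suc N ℕ.* 12) ≤ n → m ≤ n → N < heckeExponent n m
heckeExponent-large N n m large m≤n = begin
  suc N                                        ≡⟨ m*n/n≡m (suc N) 12 ⟨
  (suc N ℕ.* 12) / 12                          ≤⟨ /-monoˡ-≤ 12 (ℕₚ.∸-monoˡ-≤ 1 bound) ⟩
  heckeExponent n m                            ∎
  where
  open ℕₚ.≤-Reasoning
  n² : ℕ
  n² = n ℕ.* n

  n≤n² : n ≤ n²
  n≤n² = ℕₚ.m≤m*n n n ⦃ ℕ.>-nonZero (ℕₚ.≤-trans (s≤s z≤n) large) ⦄

  bound : suc (suc N ℕ.* 12) ≤ (3 ℕ.* n² ∸ m ℕ.* m) / 2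
  bound = begin
    suc (suc N ℕ.* 12)        ≤⟨ large ⟩
    n                         ≤⟨ n≤n² ⟩
    n²                        ≡⟨ m*n/n≡m n² 2 ⟨
    (n² ℕ.* 2) / 2            ≡⟨ cong (_/ 2) (ℕₚ.*-comm n² 2) ⟩
    (2 ℕ.* n²) / 2            ≡⟨ cong (_/ 2) (ℕₚ.m+n∸m≡n n² (2 ℕ.* n²)) ⟨
    (3 ℕ.* n² ∸ n²) / 2       ≤⟨ /-monoˡ-≤ 2 (ℕₚ.∸-monoʳ-≤ (3 ℕ.* n²) (ℕₚ.*-mono-≤ m≤n m≤n)) ⟩
    (3 ℕ.* n² ∸ m ℕ.* m) / 2  ∎

hecke-summable : Summable λ n → ∑< (suc n) λ m → heckeSummand n m
hecke-summable = summable _ (λ N → suc (suc N ℕ.* 12)) λ N n large →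
  O-∑< (suc n)
    (λ m m<1+n i i≤N → O-monomial (heckeCoefficient n m) _ i
      (ℕₚ.≤-<-trans (ℕ.s≤s⁻¹ i≤N) (heckeExponent-large N n m large (ℕ.s≤s⁻¹ m<1+n))))
    N (ℕₚ.n<1+n N)

{-# OPTIONS --safe #-}

-- Multiplication by (z;q)_∞ (z⁻¹;q)_∞ turns S into ∑ qⁿ (z;q)_n (z⁻¹;q)_n (qⁿ⁺¹;q)_∞.
-- The finite Jacobi triple product and a summation by parts expand
-- (z;q)_n (z⁻¹;q)_n in v_h = z^h + z^-h - 2 = (1 - z^h)² z^-h.  Up to a sign and
-- a power of q, the coefficient of v_{k+1} in the product side is then a sum γ(k)
-- of q-hypergeometric terms, and creative telescoping gives
--   γ(k) = q^{k+1} (1 - q^{2k+4}) + q^{3k+5} γ(k+2).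
-- Iterating this yields the partial theta series that results on the other side
-- from fixing h = (n - m)/2 = k + 1 and summing over m = 6l + 1 and m = 6l + 5.
-- The coefficient of q^N is compared modulo q^{N+1}: there q is nilpotent, so
-- that all the products and sums are finite.

module Submission where

open import Defs using (module PowerSeries)
open import Algebra.Bundles using (CommutativeRing; RawRing)
import Algebra.Solver.Ring
open import Algebra.Solver.Ring.AlmostCommutativeRing
  using (fromCommutativeRing; _-Raw-AlmostCommutative⟶_)
open import Data.Bool.Base using (true; false)
open import Data.Integer.Base as ℤ using (ℤ; +_; -[1+_]; 0ℤ; 1ℤ; -1ℤ)
import Data.Integer.Properties as ℤₚ
open import Data.Maybe.Base using (Maybe; just; nothing)
open import Data.Nat.Base as ℕ using (ℕ; zero; suc; _∸_; _≤_; _<_; z≤n; s≤s)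
open import Data.Nat.DivMod using (_/_; _%_; m*n/n≡m)
import Data.Nat.Properties as ℕₚ
import Data.Nat.Tactic.RingSolver as ℕSolver
open import Data.Product.Base using (_,_; proj₁; proj₂; ∃-syntax)
open import Data.Sum.Base using (_⊎_; inj₁; inj₂)
open import Function.Base using (_∘_)
open import Relation.Binary.PropositionalEquality as ≡ using (_≡_)
open import Relation.Nullary.Decidable using (does; yes; no)

-- The ring at hand has no division, so 1/(q;q)_n is written as (q^(n+1);q)_∞ / (q;q)_∞. The single
-- inverse `e⁻¹` of (q;q)_∞ then supplies every denominator, and `e-step` alone produces or absorbs
-- a factor 1 - q^n. Each q-hypergeometric identity is proved by writing all its terms as polynomial
-- multiples of one common product, the one with the largest denominators. What remains is a
-- polynomial identity in q, q^k and q^(m-k), which the ring solver decides. The exponent m - k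
-- forces the recurring split into k ≤ m and m < k; in the latter case every term has a vanishing
-- factor. The inhomogeneous term in the recurrence of γ is the upper end of the telescoped sum. At
-- a finite cutoff that end is 1 only up to an error, and the prefactor q^(k+1) kills the error.

-- Normalisation of ring expressions with integer coefficients.

module IntegerSolver {c ℓ} (R : CommutativeRing c ℓ) where

  open CommutativeRing R
  open import Algebra.Properties.Ring ring using (-0#≈0#; -‿distribˡ-*; -‿involutive)
  open import Algebra.Properties.AbelianGroup +-abelianGroup using (⁻¹-∙-comm)
  open import Algebra.Properties.Semiring.Mult.TCOptimised semiring
    using (1+×; ×-homo-+; ×1-homo-*) renaming (_×_ to _×′_)
  open import Relation.Binary.Reasoning.Setoid setoid

  -- With this multiple, `0 ×′ 1#` and `1 ×′ 1#` compute to `0#` and `1#`, so `con 0ℤ` and `con 1ℤ`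
  -- match the ring constants definitionally.
  ⟦_⟧ℤ : ℤ → Carrier
  ⟦ + n ⟧ℤ      = n ×′ 1#
  ⟦ -[1+ n ] ⟧ℤ = - (suc n ×′ 1#)

  -‿homo : ∀ i → ⟦ ℤ.- i ⟧ℤ ≈ - ⟦ i ⟧ℤ
  -‿homo (+ zero)   = sym -0#≈0#
  -‿homo (+ suc n)  = refl
  -‿homo -[1+ n ]   = sym (-‿involutive _)

  ⊖-homo : ∀ m n → ⟦ m ℤ.⊖ n ⟧ℤ ≈ m ×′ 1# - n ×′ 1#
  ⊖-homo m       zero    = begin
    ⟦ m ℤ.⊖ 0 ⟧ℤ  ≡⟨ ≡.cong ⟦_⟧ℤ (ℤₚ.⊖-≥ {m} z≤n) ⟩
    m ×′ 1#       ≈⟨ +-identityʳ _ ⟨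
    m ×′ 1# + 0#  ≈⟨ +-congˡ -0#≈0# ⟨
    m ×′ 1# - 0#  ∎
  ⊖-homo zero    (suc n) = sym (+-identityˡ _)
  ⊖-homo (suc m) (suc n) = begin
    ⟦ suc m ℤ.⊖ suc n ⟧ℤ                      ≡⟨ ≡.cong ⟦_⟧ℤ (ℤₚ.[1+m]⊖[1+n]≡m⊖n m n) ⟩
    ⟦ m ℤ.⊖ n ⟧ℤ                              ≈⟨ ⊖-homo m n ⟩
    m ×′ 1# - n ×′ 1#                         ≈⟨ +-congʳ (+-identityʳ _) ⟨
    (m ×′ 1# + 0#) - n ×′ 1#                  ≈⟨ +-congʳ (+-congˡ (-‿inverseʳ 1#)) ⟨
    (m ×′ 1# + (1# - 1#)) - n ×′ 1#           ≈⟨ +-congʳ (+-assoc _ _ _) ⟨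
    ((m ×′ 1# + 1#) - 1#) - n ×′ 1#           ≈⟨ +-assoc _ _ _ ⟩
    (m ×′ 1# + 1#) + (- 1# - n ×′ 1#)         ≈⟨ +-cong (+-comm _ _) (⁻¹-∙-comm 1# _) ⟩
    (1# + m ×′ 1#) - (1# + n ×′ 1#)           ≈⟨ +-cong (1+× m 1#) (-‿cong (1+× n 1#)) ⟨
    suc m ×′ 1# - suc n ×′ 1#                 ∎

  +-homo : ∀ i j → ⟦ i ℤ.+ j ⟧ℤ ≈ ⟦ i ⟧ℤ + ⟦ j ⟧ℤ
  +-homo (+ m)    (+ n)    = ×-homo-+ 1# m n
  +-homo (+ m)    -[1+ n ] = ⊖-homo m (suc n)
  +-homo -[1+ m ] (+ n)    = trans (⊖-homo n (suc m)) (+-comm _ _)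
  +-homo -[1+ m ] -[1+ n ] = begin
    - (suc (suc (m ℕ.+ n)) ×′ 1#)        ≡⟨ ≡.cong (λ k → - (suc k ×′ 1#)) (ℕₚ.+-suc m n) ⟨
    - ((suc m ℕ.+ suc n) ×′ 1#)          ≈⟨ -‿cong (×-homo-+ 1# (suc m) (suc n)) ⟩
    - (suc m ×′ 1# + suc n ×′ 1#)        ≈⟨ ⁻¹-∙-comm _ _ ⟨
    - (suc m ×′ 1#) - suc n ×′ 1#        ∎

  +*-homo : ∀ m j → ⟦ + m ℤ.* j ⟧ℤ ≈ ⟦ + m ⟧ℤ * ⟦ j ⟧ℤ
  +*-homo zero    j = begin
    ⟦ 0ℤ ℤ.* j ⟧ℤ ≡⟨ ≡.cong ⟦_⟧ℤ (ℤₚ.*-zeroˡ j) ⟩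
    0#            ≈⟨ zeroˡ _ ⟨
    0# * ⟦ j ⟧ℤ   ∎
  +*-homo (suc m) j = begin
    ⟦ + suc m ℤ.* j ⟧ℤ              ≡⟨ ≡.cong ⟦_⟧ℤ (ℤₚ.suc-* (+ m) j) ⟩
    ⟦ j ℤ.+ + m ℤ.* j ⟧ℤ            ≈⟨ +-homo j _ ⟩
    ⟦ j ⟧ℤ + ⟦ + m ℤ.* j ⟧ℤ         ≈⟨ +-cong (sym (*-identityˡ _)) (+*-homo m j) ⟩
    1# * ⟦ j ⟧ℤ + ⟦ + m ⟧ℤ * ⟦ j ⟧ℤ ≈⟨ distribʳ _ _ _ ⟨
    (1# + ⟦ + m ⟧ℤ) * ⟦ j ⟧ℤ        ≈⟨ *-congʳ (1+× m 1#) ⟨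
    ⟦ + suc m ⟧ℤ * ⟦ j ⟧ℤ           ∎

  *-homo : ∀ i j → ⟦ i ℤ.* j ⟧ℤ ≈ ⟦ i ⟧ℤ * ⟦ j ⟧ℤ
  *-homo (+ m)    j = +*-homo m j
  *-homo -[1+ m ] j = begin
    ⟦ -[1+ m ] ℤ.* j ⟧ℤ          ≡⟨ ≡.cong ⟦_⟧ℤ (ℤₚ.neg-distribˡ-* (+ suc m) j) ⟨
    ⟦ ℤ.- (+ suc m ℤ.* j) ⟧ℤ     ≈⟨ -‿homo (+ suc m ℤ.* j) ⟩
    - ⟦ + suc m ℤ.* j ⟧ℤ         ≈⟨ -‿cong (+*-homo (suc m) j) ⟩
    - (⟦ + suc m ⟧ℤ * ⟦ j ⟧ℤ)    ≈⟨ -‿distribˡ-* _ _ ⟩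
    - ⟦ + suc m ⟧ℤ * ⟦ j ⟧ℤ      ∎

  private
    ℤ-rawRing : RawRing _ _
    ℤ-rawRing = record
      { Carrier = ℤ ; _≈_ = _≡_ ; _+_ = ℤ._+_ ; _*_ = ℤ._*_ ; -_ = ℤ.-_ ; 0# = 0ℤ ; 1# = 1ℤ }

    morphism : ℤ-rawRing -Raw-AlmostCommutative⟶ fromCommutativeRing R
    morphism = record
      { ⟦_⟧ = ⟦_⟧ℤ ; +-homo = +-homo ; *-homo = *-homo ; -‿homo = -‿homo
      ; 0-homo = refl ; 1-homo = refl }

    -- Like terms cancel by a decision made in ℤ, because equality in `R` is not decidable in
    -- general. Distinct integers may still agree in `R`, hence `Maybe`.
    _≈?_ : ∀ i j → Maybe (⟦ i ⟧ℤ ≈ ⟦ j ⟧ℤ)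
    i ≈? j with i ℤₚ.≟ j
    ... | yes ≡.refl = just (refl)
    ... | no _     = nothing

  open Algebra.Solver.Ring ℤ-rawRing (fromCommutativeRing R) morphism _≈?_ public

-- Rearrangement of finite sums.

module Sums {c ℓ} (R : CommutativeRing c ℓ) where

  open CommutativeRing R
  open import Relation.Binary.Reasoning.Setoid setoid
  open PowerSeries R public using () renaming (sumBelow to ∑; sumBelow-zero to ∑-zero; sumBelow-head to ∑-head)
  open IntegerSolver R

  ∑-cong : ∀ n {f g} → (∀ i → i < n → f i ≈ g i) → ∑ n f ≈ ∑ n g
  ∑-cong zero    f≈g = refl
  ∑-cong (suc n) f≈g = +-cong (∑-cong n λ i i<n → f≈g i (ℕₚ.m<n⇒m<1+n i<n)) (f≈g n (ℕₚ.n<1+n n))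

  ∑-+ : ∀ n f g → ∑ n (λ i → f i + g i) ≈ ∑ n f + ∑ n g
  ∑-+ zero    f g = sym (+-identityˡ 0#)
  ∑-+ (suc n) f g = begin
    ∑ n (λ i → f i + g i) + (f n + g n)  ≈⟨ +-congʳ (∑-+ n f g) ⟩
    (∑ n f + ∑ n g) + (f n + g n)        ≈⟨ solve 4 (λ a b c d → (a :+ b) :+ (c :+ d) := (a :+ c) :+ (b :+ d)) refl _ _ _ _ ⟩
    (∑ n f + f n) + (∑ n g + g n)        ∎

  ∑-*ˡ : ∀ n a f → ∑ n (λ i → a * f i) ≈ a * ∑ n f
  ∑-*ˡ zero    a f = sym (zeroʳ a)
  ∑-*ˡ (suc n) a f = trans (+-congʳ (∑-*ˡ n a f)) (sym (distribˡ a _ _))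

  ∑-swap : ∀ m n (f : ℕ → ℕ → Carrier) → ∑ m (λ i → ∑ n (f i)) ≈ ∑ n (λ j → ∑ m (λ i → f i j))
  ∑-swap zero    n f = sym (∑-zero n λ _ _ → refl)
  ∑-swap (suc m) n f = trans (+-congʳ (∑-swap m n f)) (sym (∑-+ n _ _))

  ∑-telescope : ∀ n (f : ℕ → Carrier) → ∑ n (λ i → f (suc i) - f i) ≈ f n - f 0
  ∑-telescope zero    f = sym (-‿inverseʳ (f 0))
  ∑-telescope (suc n) f = begin
    ∑ n (λ i → f (suc i) - f i) + (f (suc n) - f n)  ≈⟨ +-congʳ (∑-telescope n f) ⟩
    (f n - f 0) + (f (suc n) - f n)                  ≈⟨ solve 3 (λ a b c → (a :- b) :+ (c :- a) := c :- b) refl _ _ _ ⟩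
    f (suc n) - f 0                                  ∎

  ∑-extend : ∀ {m n f} → m ≤ n → (∀ i → m ≤ i → f i ≈ 0#) → ∑ n f ≈ ∑ m f
  ∑-extend {m} {n} {f} m≤n f≈0 = go (ℕₚ.≤⇒≤′ m≤n)
    where
    go : ∀ {n} → m ℕ.≤′ n → ∑ n f ≈ ∑ m f
    go ℕ.≤′-refl         = refl
    go (ℕ.≤′-step {n} m≤n) = trans (+-cong (go m≤n) (f≈0 n (ℕₚ.≤′⇒≤ m≤n))) (+-identityʳ _)

  -- Induction adds the row `i = n`, which lengthens every earlier column by one term and opens a
  -- new column. For the Hecke sum it introduces the coordinate d = n - m, on which alone the
  -- exponents of z depend.
  ∑-triangle : ∀ n (f : ℕ → ℕ → Carrier) →
    ∑ n (λ i → ∑ (suc i) (f i)) ≈ ∑ n (λ j → ∑ (n ∸ j) (λ d → f (j ℕ.+ d) j))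
  ∑-triangle zero    f = refl
  ∑-triangle (suc n) f = begin
    ∑ n (λ i → ∑ (suc i) (f i)) + (∑ n (f n) + f n n)
      ≈⟨ +-congʳ (∑-triangle n f) ⟩
    ∑ n column + (∑ n (f n) + f n n)
      ≈⟨ +-assoc _ _ _ ⟨
    (∑ n column + ∑ n (f n)) + f n n
      ≈⟨ +-cong (sym (∑-+ n _ _)) (sym corner) ⟩
    ∑ n (λ j → column j + f n j) + ∑ (suc n ∸ n) (λ d → f (n ℕ.+ d) n)
      ≈⟨ +-congʳ (∑-cong n extended) ⟩
    ∑ n (λ j → ∑ (suc n ∸ j) (λ d → f (j ℕ.+ d) j)) + ∑ (suc n ∸ n) (λ d → f (n ℕ.+ d) n) ∎
    where
    column : ℕ → Carrier
    column j = ∑ (n ∸ j) (λ d → f (j ℕ.+ d) j)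

    extended : ∀ j → j < n → column j + f n j ≈ ∑ (suc n ∸ j) (λ d → f (j ℕ.+ d) j)
    extended j j<n rewrite ℕₚ.+-∸-assoc 1 (ℕₚ.<⇒≤ j<n) | ℕₚ.m+[n∸m]≡n (ℕₚ.<⇒≤ j<n) = refl

    corner : ∑ (suc n ∸ n) (λ d → f (n ℕ.+ d) n) ≈ f n n
    corner rewrite ℕₚ.m+n∸n≡m 1 n | ℕₚ.+-identityʳ n = +-identityˡ _

  ∑-++ : ∀ k m f → ∑ (k ℕ.+ m) f ≈ ∑ m f + ∑ k (λ j → f (j ℕ.+ m))
  ∑-++ zero    m f = sym (+-identityʳ _)
  ∑-++ (suc k) m f = trans (+-congʳ (∑-++ k m f)) (+-assoc _ _ _)

  -- Applied with blocks of 6 to sort m by residue, and with blocks of 2 to sort n - m by parity.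
  ∑-blocks : ∀ n k f → ∑ (n ℕ.* k) f ≈ ∑ n (λ i → ∑ k (λ j → f (j ℕ.+ i ℕ.* k)))
  ∑-blocks zero    k f = refl
  ∑-blocks (suc n) k f = trans (∑-++ k (n ℕ.* k) f) (+-congʳ (∑-blocks n k f))

-- The difference comes with an equation that can be matched on: `m` becomes `k + r`, and q^m then
-- factors as q^k q^r.
≤-or-> : ∀ k m → (∃[ r ] k ℕ.+ r ≡ m) ⊎ m < k
≤-or-> k m with ℕₚ.≤-<-connex k m
... | inj₁ k≤m = inj₁ (m ∸ k , ℕₚ.m+[n∸m]≡n k≤m)
... | inj₂ m<k = inj₂ m<k

-- Exponents of the partial theta series.

triangular : ℕ → ℕ
triangular zero    = 0
triangular (suc n) = triangular n ℕ.+ suc n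

-- The exponents of q in the partial theta expansion θ of γ below.
α β : ℕ → ℕ → ℕ
α l k = 3 ℕ.* (l ℕ.* l) ℕ.+ l ℕ.+ 3 ℕ.* (l ℕ.* suc k) ℕ.+ suc k
β l k = α l k ℕ.+ (4 ℕ.* l ℕ.+ 2 ℕ.* suc (suc k))

-- One step in `l` is traded for two steps in `k`; the leftover 3k + 5 is the exponent of q in front
-- of γ(k+2), so that `θ` obeys the recurrence of `γ`.
α-suc : ∀ l k → α (suc l) k ≡ (5 ℕ.+ 3 ℕ.* k) ℕ.+ α l (suc (suc k))
α-suc = expanded
  where
  expanded : ∀ l k →
    3 ℕ.* (suc l ℕ.* suc l) ℕ.+ suc l ℕ.+ 3 ℕ.* (suc l ℕ.* suc k) ℕ.+ suc k
      ≡ (5 ℕ.+ 3 ℕ.* k)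
          ℕ.+ (3 ℕ.* (l ℕ.* l) ℕ.+ l ℕ.+ 3 ℕ.* (l ℕ.* suc (suc (suc k))) ℕ.+ suc (suc (suc k)))
  expanded = ℕSolver.solve-∀

β-suc : ∀ l k → β (suc l) k ≡ (5 ℕ.+ 3 ℕ.* k) ℕ.+ β l (suc (suc k))
β-suc l k = ≡.trans
  (≡.cong₂ ℕ._+_ (α-suc l k) (shift l k))
  (ℕₚ.+-assoc (5 ℕ.+ 3 ℕ.* k) (α l (suc (suc k))) _)
  where
  shift : ∀ l k → 4 ℕ.* suc l ℕ.+ 2 ℕ.* suc (suc k) ≡ 4 ℕ.* l ℕ.+ 2 ℕ.* suc (suc (suc (suc k)))
  shift = ℕSolver.solve-∀

-- The q-series identity over a ring in which q is nilpotent.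

module EulerProducts {c ℓ} (R : CommutativeRing c ℓ) where

  open CommutativeRing R hiding (zero)
  open import Algebra.Properties.Semiring.Exp semiring using (_^_; ^-homo-*; ^-assocʳ)
  open import Relation.Binary.Reasoning.Setoid setoid
  open IntegerSolver R using (solve; _:=_; _:+_; _:*_; _:-_; :-_; _:^_; con)
  open Sums R

  -- e n stands for (qⁿ;q)_∞, read modulo q^D.
  module Identity (q : Carrier) (D : ℕ) (q^D≈0 : q ^ D ≈ 0#)
    (e : ℕ → Carrier) (e-step : ∀ n → e n ≈ (1# - q ^ n) * e (suc n))
    (e-large : ∀ n → D ≤ n → e n ≈ 1#)
    (e⁻¹ : Carrier) (e-inverse : e 1 * e⁻¹ ≈ 1#)
    where

    q^large≈0 : ∀ n → D ≤ n → q ^ n ≈ 0#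
    q^large≈0 n D≤n = begin
      q ^ n                  ≡⟨ ≡.cong (q ^_) (ℕₚ.m+[n∸m]≡n D≤n) ⟨
      q ^ (D ℕ.+ (n ∸ D))    ≈⟨ ^-homo-* q D (n ∸ D) ⟩
      q ^ D * q ^ (n ∸ D)    ≈⟨ *-congʳ q^D≈0 ⟩
      0# * q ^ (n ∸ D)       ≈⟨ zeroˡ _ ⟩
      0#                     ∎

    -- Every factor 1 - q^s of `e n` has s ≥ n, hence q^m q^s = 0, and `q ^ m` absorbs it. The
    -- argument `f` is fuel that bounds the number of factors before `e-large` applies.
    q^*e : ∀ f m n → D ≤ f ℕ.+ n → D ≤ m ℕ.+ n → q ^ m * e n ≈ q ^ m
    q^*e zero    m n D≤n D≤m+n = trans (*-congˡ (e-large n D≤n)) (*-identityʳ _)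
    q^*e (suc f) m n D≤f+n D≤m+n = begin
      q ^ m * e n
        ≈⟨ *-congˡ (e-step n) ⟩
      q ^ m * ((1# - q ^ n) * e (suc n))
        ≈⟨ solve 3 (λ x y w → x :* ((con 1ℤ :- y) :* w) := x :* w :- (x :* y) :* w) refl (q ^ m) (q ^ n) (e (suc n)) ⟩
      q ^ m * e (suc n) - (q ^ m * q ^ n) * e (suc n)
        ≈⟨ +-congˡ (-‿cong (*-congʳ (trans (sym (^-homo-* q m n)) (q^large≈0 _ D≤m+n)))) ⟩
      q ^ m * e (suc n) - 0# * e (suc n)
        ≈⟨ solve 2 (λ x w → x :* w :- con 0ℤ :* w := x :* w) refl (q ^ m) (e (suc n)) ⟩
      q ^ m * e (suc n)
        ≈⟨ q^*e f m (suc n)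
             (≡.subst (D ≤_) (≡.sym (ℕₚ.+-suc f n)) D≤f+n)
             (ℕₚ.≤-trans D≤m+n (ℕₚ.+-monoʳ-≤ m (ℕₚ.n≤1+n n))) ⟩
      q ^ m ∎

    -- 1/(q;q)_n
    i : ℕ → Carrier
    i n = e⁻¹ * e (suc n)

    i-step : ∀ n → i n ≈ (1# - q * q ^ n) * i (suc n)
    i-step n = begin
      e⁻¹ * e (suc n)
        ≈⟨ *-congˡ (e-step (suc n)) ⟩
      e⁻¹ * ((1# - q * q ^ n) * e (suc (suc n)))
        ≈⟨ solve 3 (λ x y w → x :* (y :* w) := y :* (x :* w)) refl e⁻¹ (1# - q * q ^ n) (e (suc (suc n))) ⟩
      (1# - q * q ^ n) * i (suc n) ∎

    i0≈1 : i 0 ≈ 1#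
    i0≈1 = trans (*-comm _ _) e-inverse

    -- 1/(q;q)_{m-k}, read as 0 when m < k.
    j : ℕ → ℕ → Carrier
    j m       zero    = i m
    j zero    (suc k) = 0#
    j (suc m) (suc k) = j m k

    j-zero : ∀ {m k} → m < k → j m k ≡ 0#
    j-zero {zero}  {suc k} m<k       = ≡.refl
    j-zero {suc m} {suc k} (s≤s m<k) = j-zero m<k

    j-+ : ∀ k r s → j (k ℕ.+ r) (k ℕ.+ s) ≡ j r s
    j-+ zero    r s = ≡.refl
    j-+ (suc k) r s = j-+ k r s

    j-+₀ : ∀ k r → j (k ℕ.+ r) k ≡ i r
    j-+₀ zero    r = ≡.refl
    j-+₀ (suc k) r = j-+₀ k r

    j₁ : ∀ r → j r 1 ≈ (1# - q ^ r) * i r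
    j₁ zero    = solve 1 (λ x → con 0ℤ := (con 1ℤ :- con 1ℤ) :* x) refl (i 0)
    j₁ (suc r) = i-step r

    -- The expected factor 1 - q^(r-1) has no meaning at r = 0; multiplication by q turns it into q
    -- - q^r. For r < 2 both sides vanish.
    j₂ : ∀ r → q * j r 2 ≈ (q - q ^ r) * ((1# - q ^ r) * i r)
    j₂ zero    = solve 2 (λ y x → y :* con 0ℤ := (y :- con 1ℤ) :* ((con 1ℤ :- con 1ℤ) :* x)) refl q (i 0)
    j₂ (suc r) = begin
      q * j r 1
        ≈⟨ *-congˡ (j₁ r) ⟩
      q * ((1# - q ^ r) * i r)
        ≈⟨ solve 3 (λ x y w → x :* ((con 1ℤ :- y) :* w) := (x :- x :* y) :* w) refl q (q ^ r) (i r) ⟩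
      (q - q * q ^ r) * i r
        ≈⟨ *-congˡ (i-step r) ⟩
      (q - q * q ^ r) * ((1# - q * q ^ r) * i (suc r)) ∎

    j₁-+ : ∀ k r → j (k ℕ.+ r) (suc k) ≈ (1# - q ^ r) * i r
    j₁-+ k r = begin
      j (k ℕ.+ r) (suc k)      ≡⟨ ≡.cong (j (k ℕ.+ r)) (ℕₚ.+-comm 1 k) ⟩
      j (k ℕ.+ r) (k ℕ.+ 1)    ≡⟨ j-+ k r 1 ⟩
      j r 1                    ≈⟨ j₁ r ⟩
      (1# - q ^ r) * i r       ∎

    j₂-+ : ∀ k r → q * j (k ℕ.+ r) (suc (suc k)) ≈ (q - q ^ r) * ((1# - q ^ r) * i r)
    j₂-+ k r = begin
      q * j (k ℕ.+ r) (suc (suc k))              ≡⟨ ≡.cong (λ n → q * j (k ℕ.+ r) n) (ℕₚ.+-comm 2 k) ⟩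
      q * j (k ℕ.+ r) (k ℕ.+ 2)                  ≡⟨ ≡.cong (q *_) (j-+ k r 2) ⟩
      q * j r 2                                  ≈⟨ j₂ r ⟩
      (q - q ^ r) * ((1# - q ^ r) * i r)         ∎

    -- (q;q)_{2m+1}
    a : ℕ → Carrier
    a zero    = 1# - q
    a (suc m) = a m * ((1# - q ^ 2 * (q ^ m) ^ 2) * (1# - q ^ 3 * (q ^ m) ^ 2))

    private
      q^-double : ∀ m → q ^ (m ℕ.+ m) ≈ (q ^ m) ^ 2
      q^-double m = trans (^-homo-* q m m) (solve 1 (λ x → x :* x := x :^ 2) refl (q ^ m))

    a*e : ∀ m → a m * e (suc (suc (m ℕ.+ m))) ≈ e 1
    a*e zero    = trans
      (solve 2 (λ x y → (con 1ℤ :- x) :* y := (con 1ℤ :- x :* con 1ℤ) :* y) refl q (e 2))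
      (sym (e-step 1))
    a*e (suc m) = begin
      a m * ((1# - q ^ 2 * (q ^ m) ^ 2) * (1# - q ^ 3 * (q ^ m) ^ 2)) * e (suc (suc (suc m ℕ.+ suc m)))
        ≡⟨ ≡.cong (λ n → a (suc m) * e (suc (suc (suc n)))) (ℕₚ.+-suc m m) ⟩
      a m * ((1# - q ^ 2 * (q ^ m) ^ 2) * (1# - q ^ 3 * (q ^ m) ^ 2)) * e (4 ℕ.+ (m ℕ.+ m))
        ≈⟨ solve 4 (λ q y a e →
             a :* ((con 1ℤ :- q :^ 2 :* y) :* (con 1ℤ :- q :^ 3 :* y)) :* e
               := a :* ((con 1ℤ :- q :* (q :* y)) :* ((con 1ℤ :- q :* (q :* (q :* y))) :* e)))
             refl q ((q ^ m) ^ 2) (a m) (e (4 ℕ.+ (m ℕ.+ m))) ⟩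
      a m * ((1# - q * (q * (q ^ m) ^ 2)) * ((1# - q * (q * (q * (q ^ m) ^ 2))) * e (4 ℕ.+ (m ℕ.+ m))))
        ≈⟨ *-congˡ (*-cong (+-congˡ (-‿cong (*-congˡ (*-congˡ (q^-double m)))))
             (*-congʳ (+-congˡ (-‿cong (*-congˡ (*-congˡ (*-congˡ (q^-double m)))))))) ⟨
      a m * ((1# - q ^ (2 ℕ.+ (m ℕ.+ m))) * ((1# - q ^ (3 ℕ.+ (m ℕ.+ m))) * e (4 ℕ.+ (m ℕ.+ m))))
        ≈⟨ *-congˡ (trans (e-step (2 ℕ.+ (m ℕ.+ m))) (*-congˡ (e-step (3 ℕ.+ (m ℕ.+ m))))) ⟨
      a m * e (2 ℕ.+ (m ℕ.+ m))
        ≈⟨ a*e m ⟩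
      e 1 ∎

    -- W is the q-Zeilberger certificate of t for the recurrence of γ below.

    t W : ℕ → ℕ → Carrier
    t m k = q * q ^ m * (1# + q * q ^ k) * a m * e (suc m) * j m k * i (suc (suc (m ℕ.+ k)))
    W m k = a m * e (suc m) * j m (suc k) * i (suc (suc (suc (m ℕ.+ k))))

    private
      i-+₃ : ∀ m k → i (suc (suc (suc (m ℕ.+ k)))) ≈ (1# - q ^ 4 * (q ^ m * q ^ k)) * i (4 ℕ.+ (m ℕ.+ k))
      i-+₃ m k = trans (i-step (3 ℕ.+ (m ℕ.+ k))) (*-congʳ (+-congˡ (-‿cong (trans
        (solve 2 (λ q y → q :* (q :* (q :* (q :* y))) := q :^ 4 :* y) refl q (q ^ (m ℕ.+ k)))
        (*-congˡ (^-homo-* q m k))))))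

      i-+₂ : ∀ m k → i (suc (suc (m ℕ.+ k))) ≈ (1# - q ^ 3 * (q ^ m * q ^ k)) * i (3 ℕ.+ (m ℕ.+ k))
      i-+₂ m k = trans (i-step (2 ℕ.+ (m ℕ.+ k))) (*-congʳ (+-congˡ (-‿cong (trans
        (solve 2 (λ q y → q :* (q :* (q :* y)) := q :^ 3 :* y) refl q (q ^ (m ℕ.+ k)))
        (*-congˡ (^-homo-* q m k))))))

      i-+₁ : ∀ m k → i (suc (m ℕ.+ k)) ≈ (1# - q ^ 2 * (q ^ m * q ^ k)) * i (2 ℕ.+ (m ℕ.+ k))
      i-+₁ m k = trans (i-step (1 ℕ.+ (m ℕ.+ k))) (*-congʳ (+-congˡ (-‿cong (trans
        (solve 2 (λ q y → q :* (q :* y) := q :^ 2 :* y) refl q (q ^ (m ℕ.+ k)))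
        (*-congˡ (^-homo-* q m k))))))

    -- Creative telescoping in m at fixed k: summed over m, the right side collapses to boundary
    -- values of `W`. For m < k all four terms contain a vanishing `j`; this includes `W (suc m) k`,
    -- because `j (suc m) (suc k)` computes to `j m k`.
    t-recurrence : ∀ m k →
      t m k - q ^ 5 * (q ^ k) ^ 3 * t m (suc (suc k)) ≈ q * q ^ k * (1# - q ^ 4 * (q ^ k) ^ 2) * (W (suc m) k - W m k)
    t-recurrence m k with ≤-or-> k m
    ... | inj₂ m<k = begin
      t m k - q ^ 5 * (q ^ k) ^ 3 * t m (suc (suc k))
        ≈⟨ +-cong (vanish (j-zero m<k)) (-‿cong (*-congˡ (vanish (j-zero (ℕₚ.m<n⇒m<1+n (ℕₚ.m<n⇒m<1+n m<k)))))) ⟩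
      0# - q ^ 5 * (q ^ k) ^ 3 * 0#
        ≈⟨ solve 2 (λ x y → con 0ℤ :- x :* con 0ℤ := y :* (con 0ℤ :- con 0ℤ)) refl
             (q ^ 5 * (q ^ k) ^ 3) (q * q ^ k * (1# - q ^ 4 * (q ^ k) ^ 2)) ⟩
      q * q ^ k * (1# - q ^ 4 * (q ^ k) ^ 2) * (0# - 0#)
        ≈⟨ *-congˡ (+-cong (vanish (j-zero m<k)) (-‿cong (vanish (j-zero (ℕₚ.m<n⇒m<1+n m<k))))) ⟨
      q * q ^ k * (1# - q ^ 4 * (q ^ k) ^ 2) * (W (suc m) k - W m k) ∎
      where
      vanish : ∀ {x y w} → y ≡ 0# → x * y * w ≈ 0#
      vanish {x} {y} {w} ≡.refl = trans (*-congʳ (zeroʳ x)) (zeroˡ w)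
    ... | inj₁ (r , ≡.refl) = begin
      t m k - q ^ 5 * x ^ 3 * t m (suc (suc k))
        ≈⟨ +-cong t≈ (-‿cong t₂≈) ⟩
      q * y * (1# + q * x) * A * ((1# - q * y) * E) * J * ((1# - q ^ 3 * (y * x)) * ((1# - q ^ 4 * (y * x)) * I))
        - q ^ 5 * x ^ 3 * (y * (1# + q * (q * (q * x))) * A * ((1# - q * y) * E) * ((q - P) * ((1# - P) * J)) * I)
        ≈⟨ solve 7 (λ q x P A E J I →
             let y = x :* P in
             q :* y :* (con 1ℤ :+ q :* x) :* A :* ((con 1ℤ :- q :* y) :* E) :* J
                 :* ((con 1ℤ :- q :^ 3 :* (y :* x)) :* ((con 1ℤ :- q :^ 4 :* (y :* x)) :* I))
               :- q :^ 5 :* x :^ 3 :* (y :* (con 1ℤ :+ q :* (q :* (q :* x))) :* A :* ((con 1ℤ :- q :* y) :* E)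
                     :* ((q :- P) :* ((con 1ℤ :- P) :* J)) :* I)
               := q :* x :* (con 1ℤ :- q :^ 4 :* x :^ 2)
                    :* (A :* ((con 1ℤ :- q :^ 2 :* y :^ 2) :* (con 1ℤ :- q :^ 3 :* y :^ 2)) :* E :* J :* I
                       :- A :* ((con 1ℤ :- q :* y) :* E) :* ((con 1ℤ :- P) :* J) :* ((con 1ℤ :- q :^ 4 :* (y :* x)) :* I)))
             refl q x P A E J I ⟩
      q * x * (1# - q ^ 4 * x ^ 2)
        * (A * ((1# - q ^ 2 * y ^ 2) * (1# - q ^ 3 * y ^ 2)) * E * J * I
           - A * ((1# - q * y) * E) * ((1# - P) * J) * ((1# - q ^ 4 * (y * x)) * I))
        ≈⟨ *-congˡ (+-cong W₁≈ (-‿cong W≈)) ⟨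
      q * x * (1# - q ^ 4 * x ^ 2) * (W (suc m) k - W m k) ∎
      where
      x P A E J I y : Carrier
      x = q ^ k
      P = q ^ r
      A = a m
      E = e (suc (suc m))
      J = i r
      I = i (4 ℕ.+ (m ℕ.+ k))
      y = x * P

      y≈ : q ^ m ≈ y
      y≈ = ^-homo-* q k r

      e≈ : e (suc m) ≈ (1# - q * y) * E
      e≈ = trans (e-step (suc m)) (*-congʳ (+-congˡ (-‿cong (*-congˡ y≈))))

      i₃≈ : i (3 ℕ.+ (m ℕ.+ k)) ≈ (1# - q ^ 4 * (y * x)) * I
      i₃≈ = trans (i-+₃ m k) (*-congʳ (+-congˡ (-‿cong (*-congˡ (*-congʳ y≈)))))

      i₂≈ : i (2 ℕ.+ (m ℕ.+ k)) ≈ (1# - q ^ 3 * (y * x)) * ((1# - q ^ 4 * (y * x)) * I)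
      i₂≈ = trans (i-+₂ m k) (*-cong (+-congˡ (-‿cong (*-congˡ (*-congʳ y≈)))) i₃≈)

      t≈ : t m k ≈ q * y * (1# + q * x) * A * ((1# - q * y) * E) * J
                     * ((1# - q ^ 3 * (y * x)) * ((1# - q ^ 4 * (y * x)) * I))
      t≈ = *-cong (*-cong (*-cong (*-congʳ (*-congʳ (*-congˡ y≈))) e≈) (reflexive (j-+₀ k r))) i₂≈

      t₂≈ : q ^ 5 * x ^ 3 * t m (suc (suc k))
              ≈ q ^ 5 * x ^ 3 * (y * (1# + q * (q * (q * x))) * A * ((1# - q * y) * E) * ((q - P) * ((1# - P) * J)) * I)
      t₂≈ = *-congˡ (begin
        q * q ^ m * (1# + q * (q * (q * x))) * A * e (suc m) * j m (suc (suc k)) * i (suc (suc (m ℕ.+ suc (suc k))))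
          ≡⟨ ≡.cong (λ n → q * q ^ m * (1# + q * (q * (q * x))) * A * e (suc m) * j m (suc (suc k)) * i (suc (suc n)))
               (≡.trans (ℕₚ.+-suc m (suc k)) (≡.cong suc (ℕₚ.+-suc m k))) ⟩
        q * q ^ m * (1# + q * (q * (q * x))) * A * e (suc m) * j m (suc (suc k)) * I
          -- The q split off from q^(m+1) is the one that `j₂-+` requires.
          ≈⟨ solve 7 (λ q y c A E j I → q :* y :* c :* A :* E :* j :* I := y :* c :* A :* E :* (q :* j) :* I) refl
               q (q ^ m) (1# + q * (q * (q * x))) A (e (suc m)) (j m (suc (suc k))) I ⟩
        q ^ m * (1# + q * (q * (q * x))) * A * e (suc m) * (q * j m (suc (suc k))) * I
          ≈⟨ *-congʳ (*-cong (*-cong (*-congʳ (*-congʳ y≈)) e≈) (j₂-+ k r)) ⟩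
        y * (1# + q * (q * (q * x))) * A * ((1# - q * y) * E) * ((q - P) * ((1# - P) * J)) * I ∎)

      W₁≈ : W (suc m) k ≈ A * ((1# - q ^ 2 * y ^ 2) * (1# - q ^ 3 * y ^ 2)) * E * J * I
      W₁≈ = *-congʳ (*-cong (*-congʳ (*-congˡ (*-cong
              (+-congˡ (-‿cong (*-congˡ (*-cong y≈ (*-congʳ y≈)))))
              (+-congˡ (-‿cong (*-congˡ (*-cong y≈ (*-congʳ y≈))))))))
              (reflexive (j-+₀ k r)))

      W≈ : W m k ≈ A * ((1# - q * y) * E) * ((1# - P) * J) * ((1# - q ^ 4 * (y * x)) * I)
      W≈ = *-cong (*-cong (*-congˡ e≈) (j₁-+ k r)) i₃≈

    γ : ℕ → Carrier
    γ k = e 1 * ∑ D (λ m → t m k)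

    -- Modulo q^D all factors of `W D k` but one have reached their limits. The remaining one leaves
    -- `e (suc r)` with r = D - k - 1, which q^(k+1) absorbs by `q^*e`. For D ≤ k the prefactor is
    -- itself 0.
    q*e1*W : ∀ k → q * q ^ k * (e 1 * W D k) ≈ q * q ^ k
    q*e1*W k with ≤-or-> (suc k) D
    ... | inj₂ D<1+k = begin
      q * q ^ k * (e 1 * W D k)  ≈⟨ *-congʳ (q^large≈0 (suc k) (ℕₚ.<⇒≤ D<1+k)) ⟩
      0# * (e 1 * W D k)         ≈⟨ zeroˡ _ ⟩
      0#                         ≈⟨ q^large≈0 (suc k) (ℕₚ.<⇒≤ D<1+k) ⟨
      q * q ^ k                  ∎
    ... | inj₁ (r , 1+k+r≡D) = begin
      q ^ suc k * (e 1 * W D k)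
        ≈⟨ *-congˡ (*-congˡ (*-cong (*-cong (*-cong aD≈ eD≈) jD≈) iD≈)) ⟩
      q ^ suc k * (e 1 * (e 1 * 1# * (e⁻¹ * e (suc r)) * (e⁻¹ * 1#)))
        ≈⟨ solve 4 (λ x e e⁻¹ f → x :* (e :* (e :* con 1ℤ :* (e⁻¹ :* f) :* (e⁻¹ :* con 1ℤ)))
             := (e :* e⁻¹) :* (e :* e⁻¹) :* (x :* f)) refl (q ^ suc k) (e 1) e⁻¹ (e (suc r)) ⟩
      (e 1 * e⁻¹) * (e 1 * e⁻¹) * (q ^ suc k * e (suc r))
        ≈⟨ *-cong (*-cong e-inverse e-inverse) (q^*e D (suc k) (suc r) (ℕₚ.m≤m+n D (suc r)) D≤1+k+1+r) ⟩
      1# * 1# * q ^ suc k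
        ≈⟨ solve 1 (λ x → con 1ℤ :* con 1ℤ :* x := x) refl (q ^ suc k) ⟩
      q ^ suc k ∎
      where
      D≤1+k+1+r : D ≤ suc k ℕ.+ suc r
      D≤1+k+1+r = ℕₚ.≤-trans (ℕₚ.≤-reflexive (≡.sym 1+k+r≡D)) (ℕₚ.+-monoʳ-≤ (suc k) (ℕₚ.n≤1+n r))

      aD≈ : a D ≈ e 1
      aD≈ = begin
        a D                              ≈⟨ *-identityʳ _ ⟨
        a D * 1#                         ≈⟨ *-congˡ (e-large (2 ℕ.+ (D ℕ.+ D)) (ℕₚ.≤-trans (ℕₚ.m≤m+n D D) (ℕₚ.m≤n+m _ 2))) ⟨
        a D * e (2 ℕ.+ (D ℕ.+ D))        ≈⟨ a*e D ⟩
        e 1                              ∎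

      eD≈ : e (suc D) ≈ 1#
      eD≈ = e-large (suc D) (ℕₚ.n≤1+n D)

      jD≈ : j D (suc k) ≈ e⁻¹ * e (suc r)
      jD≈ = reflexive (≡.trans (≡.cong (λ n → j n (suc k)) (≡.sym 1+k+r≡D)) (j-+₀ (suc k) r))

      iD≈ : i (3 ℕ.+ (D ℕ.+ k)) ≈ e⁻¹ * 1#
      iD≈ = *-congˡ (e-large _ (ℕₚ.≤-trans (ℕₚ.m≤m+n D k) (ℕₚ.m≤n+m _ 4)))

    γ-recurrence : ∀ k → γ k ≈ q * q ^ k * (1# - q ^ 4 * (q ^ k) ^ 2) + q ^ 5 * (q ^ k) ^ 3 * γ (suc (suc k))
    γ-recurrence k = begin
      e 1 * ∑ D (λ m → t m k)
        ≈⟨ *-congˡ (∑-cong D λ m _ → trans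
             (solve 2 (λ x y → x := (x :- y) :+ y) refl (t m k) (u * t m (suc (suc k))))
             (+-congʳ (t-recurrence m k))) ⟩
      e 1 * ∑ D (λ m → p * (W (suc m) k - W m k) + u * t m (suc (suc k)))
        ≈⟨ *-congˡ (trans (∑-+ D _ _) (+-cong (trans (∑-*ˡ D p _) (*-congˡ (∑-telescope D (λ m → W m k)))) (∑-*ˡ D u _))) ⟩
      e 1 * (p * (W D k - W 0 k) + u * ∑ D (λ m → t m (suc (suc k))))
        ≈⟨ *-congˡ (+-congʳ (*-congˡ (+-congˡ (-‿cong W0≈0)))) ⟩
      e 1 * (p * (W D k - 0#) + u * ∑ D (λ m → t m (suc (suc k))))
        ≈⟨ solve 6 (λ e x y w u s → e :* (x :* y :* (w :- con 0ℤ) :+ u :* s) := x :* (e :* w) :* y :+ u :* (e :* s)) refl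
             (e 1) (q * q ^ k) (1# - q ^ 4 * (q ^ k) ^ 2) (W D k) u (∑ D (λ m → t m (suc (suc k)))) ⟩
      q * q ^ k * (e 1 * W D k) * (1# - q ^ 4 * (q ^ k) ^ 2) + u * γ (suc (suc k))
        ≈⟨ +-congʳ (*-congʳ (q*e1*W k)) ⟩
      p + u * γ (suc (suc k)) ∎
      where
      p u : Carrier
      p = q * q ^ k * (1# - q ^ 4 * (q ^ k) ^ 2)
      u = q ^ 5 * (q ^ k) ^ 3

      W0≈0 : W 0 k ≈ 0#
      W0≈0 = trans (*-congʳ (zeroʳ _)) (zeroˡ _)

    θ : ℕ → ℕ → Carrier
    θ M k = ∑ M (λ l → q ^ α l k - q ^ β l k)

    -- The term l = 0 gives the inhomogeneous part; `α-suc` and `β-suc` extract a common power of q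
    -- from all the others.
    θ-suc : ∀ M k → θ (suc M) k ≈ q * q ^ k * (1# - q ^ 4 * (q ^ k) ^ 2) + q ^ 5 * (q ^ k) ^ 3 * θ M (suc (suc k))
    θ-suc M k = begin
      θ (suc M) k
        ≈⟨ ∑-head M _ ⟩
      (q ^ suc k - q ^ β 0 k) + ∑ M (λ l → q ^ α (suc l) k - q ^ β (suc l) k)
        ≈⟨ +-cong (trans (+-congˡ (-‿cong q^β0)) (solve 2 (λ q x → q :* x :- q :* x :* (q :* (q :* x) :* (q :* (q :* x)))
             := q :* x :* (con 1ℤ :- q :^ 4 :* x :^ 2)) refl q (q ^ k)))
             (∑-cong M λ l _ → trans (+-cong (q^-shift (α-suc l k)) (-‿cong (q^-shift (β-suc l k))))
               (solve 3 (λ u x y → u :* x :- u :* y := u :* (x :- y)) refl u (q ^ α l (suc (suc k))) (q ^ β l (suc (suc k))))) ⟩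
      q * q ^ k * (1# - q ^ 4 * (q ^ k) ^ 2) + ∑ M (λ l → u * (q ^ α l (suc (suc k)) - q ^ β l (suc (suc k))))
        ≈⟨ +-congˡ (∑-*ˡ M u _) ⟩
      q * q ^ k * (1# - q ^ 4 * (q ^ k) ^ 2) + u * θ M (suc (suc k)) ∎
      where
      u : Carrier
      u = q ^ 5 * (q ^ k) ^ 3

      q^-shift : ∀ {m n} → m ≡ (5 ℕ.+ 3 ℕ.* k) ℕ.+ n → q ^ m ≈ u * q ^ n
      q^-shift {n = n} ≡.refl = begin
        q ^ (5 ℕ.+ 3 ℕ.* k ℕ.+ n)        ≈⟨ ^-homo-* q (5 ℕ.+ 3 ℕ.* k) n ⟩
        q ^ (5 ℕ.+ 3 ℕ.* k) * q ^ n      ≈⟨ *-congʳ (^-homo-* q 5 (3 ℕ.* k)) ⟩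
        q ^ 5 * q ^ (3 ℕ.* k) * q ^ n    ≡⟨ ≡.cong (λ s → q ^ 5 * q ^ s * q ^ n) (ℕₚ.*-comm 3 k) ⟩
        q ^ 5 * q ^ (k ℕ.* 3) * q ^ n    ≈⟨ *-congʳ (*-congˡ (^-assocʳ q k 3)) ⟨
        u * q ^ n                        ∎

      q^β0 : q ^ β 0 k ≈ q * q ^ k * (q * (q * q ^ k) * (q * (q * q ^ k)))
      q^β0 = begin
        q ^ (suc k ℕ.+ (suc (suc k) ℕ.+ (suc (suc k) ℕ.+ 0)))
          ≡⟨ ≡.cong (λ n → q ^ (suc k ℕ.+ (suc (suc k) ℕ.+ n))) (ℕₚ.+-identityʳ (suc (suc k))) ⟩
        q ^ (suc k ℕ.+ (suc (suc k) ℕ.+ suc (suc k)))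
          ≈⟨ trans (^-homo-* q (suc k) _) (*-congˡ (^-homo-* q (suc (suc k)) (suc (suc k)))) ⟩
        q * q ^ k * (q * (q * q ^ k) * (q * (q * q ^ k))) ∎

    -- Each use of the two recurrences gains a power of q.
    q^*γ≈q^*θ : ∀ M N k → D ≤ N ℕ.+ M → q ^ N * γ k ≈ q ^ N * θ M k
    q^*γ≈q^*θ zero    N k D≤N = begin
      q ^ N * γ k  ≈⟨ *-congʳ (q^large≈0 N (≡.subst (D ≤_) (ℕₚ.+-identityʳ N) D≤N)) ⟩
      0# * γ k     ≈⟨ zeroˡ _ ⟩
      0#           ≈⟨ zeroʳ _ ⟨
      q ^ N * 0#   ∎
    q^*γ≈q^*θ (suc M) N k D≤N+M = begin
      q ^ N * γ k
        ≈⟨ *-congˡ (γ-recurrence k) ⟩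
      q ^ N * (p + q ^ 5 * (q ^ k) ^ 3 * γ (suc (suc k)))
        ≈⟨ expand (γ (suc (suc k))) ⟩
      q ^ N * p + q ^ 4 * (q ^ k) ^ 3 * (q ^ suc N * γ (suc (suc k)))
        ≈⟨ +-congˡ (*-congˡ (q^*γ≈q^*θ M (suc N) (suc (suc k)) (≡.subst (D ≤_) (ℕₚ.+-suc N M) D≤N+M))) ⟩
      q ^ N * p + q ^ 4 * (q ^ k) ^ 3 * (q ^ suc N * θ M (suc (suc k)))
        ≈⟨ expand (θ M (suc (suc k))) ⟨
      q ^ N * (p + q ^ 5 * (q ^ k) ^ 3 * θ M (suc (suc k)))
        ≈⟨ *-congˡ (θ-suc M k) ⟨
      q ^ N * θ (suc M) k ∎
      where
      p : Carrier
      p = q * q ^ k * (1# - q ^ 4 * (q ^ k) ^ 2)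

      expand : ∀ w → q ^ N * (p + q ^ 5 * (q ^ k) ^ 3 * w) ≈ q ^ N * p + q ^ 4 * (q ^ k) ^ 3 * (q ^ suc N * w)
      expand w = solve 5 (λ n c q x w → n :* (c :+ q :^ 5 :* x :^ 3 :* w) := n :* c :+ q :^ 4 :* x :^ 3 :* (q :* n :* w))
        refl (q ^ N) p q (q ^ k) w

    γ≈θ : ∀ k → γ k ≈ θ D k
    γ≈θ k = begin
      γ k           ≈⟨ *-identityˡ _ ⟨
      q ^ 0 * γ k   ≈⟨ q^*γ≈q^*θ D 0 k ℕₚ.≤-refl ⟩
      q ^ 0 * θ D k ≈⟨ *-identityˡ _ ⟩
      θ D k         ∎

    -- Finite Jacobi triple product

    sgn : ℕ → Carrier
    sgn zero    = 1#
    sgn (suc k) = - sgn k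

    -- The two copies of (-1)^l cancel; this is why the signs on the Hecke side depend on h and the
    -- class of m only, not on l.
    sgn-cancel : ∀ l h → sgn (l ℕ.+ h) * sgn l ≈ sgn h
    sgn-cancel zero    h = *-identityʳ _
    sgn-cancel (suc l) h = trans
      (solve 2 (λ x y → :- x :* :- y := x :* y) refl (sgn (l ℕ.+ h)) (sgn l))
      (sgn-cancel l h)

    -- `d m k` is -(-1)^k q^(k(k+1)/2) times the Gaussian binomial coefficient of 2m+1 over m-k.
    -- `d⁻ m k` stands for `d m (k - 1)`; its value at k = 0 comes from the antisymmetry of that
    -- formula under k ↦ -1-k.
    d d⁻ : ℕ → ℕ → Carrier
    d m k = - (sgn k * q ^ triangular k) * a m * j m k * i (suc (m ℕ.+ k))
    d⁻ m zero    = - d m zero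
    d⁻ m (suc k) = d m k

    d-zero : ∀ {m k} → m < k → d m k ≈ 0#
    d-zero m<k = trans (*-congʳ (trans (*-congˡ (reflexive (j-zero m<k))) (zeroʳ _))) (zeroˡ _)

    -- This mirrors multiplication by (1 - z q^(m+1)) (1 - z⁻¹ q^(m+1)) = 1 + q^(2m+2) - q^(m+1) (z
    -- + z⁻¹), where z + z⁻¹ shifts k both ways. The case k = 0 is separate because `d⁻` takes its
    -- reflected value there.
    d-suc : ∀ m k → d (suc m) k ≈ (1# + q ^ 2 * (q ^ m) ^ 2) * d m k - q * q ^ m * (d⁻ m k + d m (suc k))
    d-suc m zero rewrite ℕₚ.+-identityʳ m | ℕₚ.+-comm m 1 = begin
      - (1# * 1#) * (A * ((1# - q ^ 2 * y ^ 2) * (1# - q ^ 3 * y ^ 2))) * i (suc m) * I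
        ≈⟨ *-congʳ (*-congˡ i₁≈) ⟩
      - (1# * 1#) * (A * ((1# - q ^ 2 * y ^ 2) * (1# - q ^ 3 * y ^ 2))) * ((1# - q ^ 2 * y) * I) * I
        ≈⟨ solve 4 (λ q y A I →
             let i₁ = (con 1ℤ :- q :^ 2 :* y) :* I
                 i₀ = (con 1ℤ :- q :* y) :* i₁
                 d₀ = :- (con 1ℤ :* con 1ℤ) :* A :* i₀ :* i₁
             in
             :- (con 1ℤ :* con 1ℤ) :* (A :* ((con 1ℤ :- q :^ 2 :* y :^ 2) :* (con 1ℤ :- q :^ 3 :* y :^ 2))) :* i₁ :* I
               := (con 1ℤ :+ q :^ 2 :* y :^ 2) :* d₀
                  :- q :* y :* (:- d₀ :+ :- (:- con 1ℤ :* (q :* con 1ℤ)) :* A :* ((con 1ℤ :- y) :* i₀) :* I))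
             refl q y A I ⟩
      (1# + q ^ 2 * y ^ 2) * d₀ - q * y * (- d₀ + - (- 1# * (q * 1#)) * A * ((1# - y) * ((1# - q * y) * ((1# - q ^ 2 * y) * I))) * I)
        ≈⟨ +-cong (*-congˡ d₀≈) (-‿cong (*-congˡ (+-cong (-‿cong d₀≈) (*-congʳ (*-congˡ (trans (j₁ m) (*-congˡ i₀≈))))))) ⟨
      (1# + q ^ 2 * y ^ 2) * (- (1# * 1#) * A * i m * i (suc m))
        - q * y * (- (- (1# * 1#) * A * i m * i (suc m)) + - (- 1# * (q * 1#)) * A * j m 1 * I) ∎
      where
      y A I d₀ : Carrier
      y = q ^ m
      A = a m
      I = i (suc (suc m))
      d₀ = - (1# * 1#) * A * ((1# - q * y) * ((1# - q ^ 2 * y) * I)) * ((1# - q ^ 2 * y) * I)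

      i₁≈ : i (suc m) ≈ (1# - q ^ 2 * y) * I
      i₁≈ = trans (i-step (suc m)) (solve 3 (λ q y I → (con 1ℤ :- q :* (q :* y)) :* I := (con 1ℤ :- q :^ 2 :* y) :* I) refl q y I)

      i₀≈ : i m ≈ (1# - q * y) * ((1# - q ^ 2 * y) * I)
      i₀≈ = trans (i-step m) (*-congˡ i₁≈)

      d₀≈ : - (1# * 1#) * A * i m * i (suc m) ≈ d₀
      d₀≈ = *-cong (*-congˡ i₀≈) i₁≈
    d-suc m (suc k) with ≤-or-> k m
    ... | inj₂ m<k = begin
      d (suc m) (suc k)
        ≈⟨ d-zero (s≤s m<k) ⟩
      0#
        ≈⟨ solve 2 (λ x y → con 0ℤ := x :* con 0ℤ :- y :* (con 0ℤ :+ con 0ℤ)) refl (1# + q ^ 2 * (q ^ m) ^ 2) (q * q ^ m) ⟩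
      (1# + q ^ 2 * (q ^ m) ^ 2) * 0# - q * q ^ m * (0# + 0#)
        ≈⟨ +-cong (*-congˡ (d-zero m<1+k)) (-‿cong (*-congˡ (+-cong (d-zero m<k) (d-zero (ℕₚ.m<n⇒m<1+n m<1+k))))) ⟨
      (1# + q ^ 2 * (q ^ m) ^ 2) * d m (suc k) - q * q ^ m * (d m k + d m (suc (suc k))) ∎
      where
      m<1+k : m < suc k
      m<1+k = ℕₚ.m<n⇒m<1+n m<k
    ... | inj₁ (r , ≡.refl) rewrite ℕₚ.+-suc (k ℕ.+ r) (suc k) | ℕₚ.+-suc (k ℕ.+ r) k = begin
      - (- s * q ^ triangular (suc k)) * (A * ((1# - q ^ 2 * (q ^ m) ^ 2) * (1# - q ^ 3 * (q ^ m) ^ 2))) * j m k * I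
        ≈⟨ *-congʳ (*-cong (*-cong (-‿cong (*-congˡ τ₁≈)) (*-congˡ (*-cong
             (+-congˡ (-‿cong (*-congˡ y²≈))) (+-congˡ (-‿cong (*-congˡ y²≈)))))) (reflexive (j-+₀ k r))) ⟩
      - (- s * (τ * (q * x))) * (A * ((1# - q ^ 2 * y ^ 2) * (1# - q ^ 3 * y ^ 2))) * J * I
        ≈⟨ solve 8 (λ q x P s τ A J I →
             let y  = x :* P
                 i₂ = (con 1ℤ :- q :^ 3 :* (y :* x)) :* I
                 i₁ = (con 1ℤ :- q :^ 2 :* (y :* x)) :* i₂
             in
             :- (:- s :* (τ :* (q :* x))) :* (A :* ((con 1ℤ :- q :^ 2 :* y :^ 2) :* (con 1ℤ :- q :^ 3 :* y :^ 2))) :* J :* I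
               := (con 1ℤ :+ q :^ 2 :* y :^ 2) :* (:- (:- s :* (τ :* (q :* x))) :* A :* ((con 1ℤ :- P) :* J) :* i₂)
                  :- y :* (q :* (:- (s :* τ) :* A :* J :* i₁)
                       :+ :- (:- :- s :* (τ :* (q :* x) :* (q :* (q :* x)))) :* A :* ((q :- P) :* ((con 1ℤ :- P) :* J)) :* I))
             refl q x P s τ A J I ⟩
      (1# + q ^ 2 * y ^ 2) * (- (- s * (τ * (q * x))) * A * ((1# - P) * J) * I₂)
        - y * (q * (- (s * τ) * A * J * I₁)
               + - (- - s * (τ * (q * x) * (q * (q * x)))) * A * ((q - P) * ((1# - P) * J)) * I)
        ≈⟨ +-cong
             (*-cong (+-congˡ (*-congˡ y²≈)) (*-cong (*-cong (*-congʳ (-‿cong (*-congˡ τ₁≈))) (j₁-+ k r)) i₂≈))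
             (-‿cong (*-cong y≈ (+-cong
               (*-congˡ (*-cong (*-congˡ (reflexive (j-+₀ k r))) i₁≈))
               (*-congʳ (*-cong (*-congʳ (-‿cong (*-congˡ τ₂≈))) (j₂-+ k r)))))) ⟨
      (1# + q ^ 2 * (q ^ m) ^ 2) * d′
        - q ^ m * (q * d m k + - (- - s * q ^ triangular (suc (suc k))) * A * (q * j m (suc (suc k))) * I)
        ≈⟨ +-congˡ (-‿cong (solve 6 (λ y q d t j I → y :* (q :* d :+ t :* (q :* j) :* I) := q :* y :* (d :+ t :* j :* I)) refl
             (q ^ m) q (d m k) (- (- - s * q ^ triangular (suc (suc k))) * A) (j m (suc (suc k))) I)) ⟩
      (1# + q ^ 2 * (q ^ m) ^ 2) * d′
        - q * q ^ m * (d m k + - (- - s * q ^ triangular (suc (suc k))) * A * j m (suc (suc k)) * I) ∎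
      where
      x P s τ A J I I₁ I₂ y d′ : Carrier
      x  = q ^ k
      P  = q ^ r
      s  = sgn k
      τ  = q ^ triangular k
      A  = a m
      J  = i r
      I  = i (3 ℕ.+ (m ℕ.+ k))
      y  = x * P
      I₂ = (1# - q ^ 3 * (y * x)) * I
      I₁ = (1# - q ^ 2 * (y * x)) * I₂
      d′ = - (- s * q ^ triangular (suc k)) * A * j m (suc k) * i (2 ℕ.+ (m ℕ.+ k))

      y≈ : q ^ m ≈ y
      y≈ = ^-homo-* q k r

      y²≈ : (q ^ m) ^ 2 ≈ y ^ 2
      y²≈ = *-cong y≈ (*-congʳ y≈)

      τ₁≈ : q ^ triangular (suc k) ≈ τ * (q * x)
      τ₁≈ = ^-homo-* q (triangular k) (suc k)

      τ₂≈ : q ^ triangular (suc (suc k)) ≈ τ * (q * x) * (q * (q * x))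
      τ₂≈ = trans (^-homo-* q (triangular (suc k)) (suc (suc k))) (*-congʳ τ₁≈)

      i₂≈ : i (2 ℕ.+ (m ℕ.+ k)) ≈ I₂
      i₂≈ = trans (i-+₂ m k) (*-congʳ (+-congˡ (-‿cong (*-congˡ (*-congʳ y≈)))))

      i₁≈ : i (1 ℕ.+ (m ℕ.+ k)) ≈ I₁
      i₁≈ = trans (i-+₁ m k) (*-cong (+-congˡ (-‿cong (*-congˡ (*-congʳ y≈)))) i₂≈)

    -- The point is (1 - q^(m+k+2)) + q^(k+1) (1 - q^(m-k)) = (1 + q^(k+1)) (1 - q^(m+1)). The
    -- factor 1 - q^(m+1) later completes `e (suc (suc m))` to `e (suc m)`, which gives `t` its
    -- form.
    d-difference : ∀ m k →
      d m k - d m (suc k)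
        ≈ - (sgn k * q ^ triangular k) * ((1# + q * q ^ k) * (1# - q * q ^ m) * a m * j m k * i (suc (suc (m ℕ.+ k))))
    d-difference m k with ≤-or-> k m
    ... | inj₂ m<k = begin
      d m k - d m (suc k)
        ≈⟨ +-cong (d-zero m<k) (-‿cong (d-zero (ℕₚ.m<n⇒m<1+n m<k))) ⟩
      0# - 0#
        ≈⟨ solve 3 (λ x y w → con 0ℤ :- con 0ℤ := x :* (y :* con 0ℤ :* w)) refl _ _ _ ⟩
      - (sgn k * q ^ triangular k) * ((1# + q * q ^ k) * (1# - q * q ^ m) * a m * 0# * i (suc (suc (m ℕ.+ k))))
        ≡⟨ ≡.cong (λ u → - (sgn k * q ^ triangular k) * ((1# + q * q ^ k) * (1# - q * q ^ m) * a m * u * i (suc (suc (m ℕ.+ k))))) (j-zero m<k) ⟨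
      - (sgn k * q ^ triangular k) * ((1# + q * q ^ k) * (1# - q * q ^ m) * a m * j m k * i (suc (suc (m ℕ.+ k)))) ∎
    ... | inj₁ (r , ≡.refl) rewrite ℕₚ.+-suc (k ℕ.+ r) k = begin
      - (s * τ) * A * j m k * i (suc (m ℕ.+ k)) - - (- s * q ^ triangular (suc k)) * A * j m (suc k) * I
        ≈⟨ +-cong (*-cong (*-congˡ (reflexive (j-+₀ k r))) i₁≈)
             (-‿cong (*-congʳ (*-cong (*-congʳ (-‿cong (*-congˡ (^-homo-* q (triangular k) (suc k))))) (j₁-+ k r)))) ⟩
      - (s * τ) * A * J * ((1# - q ^ 2 * (y * x)) * I) - - (- s * (τ * (q * x))) * A * ((1# - P) * J) * I
        ≈⟨ solve 8 (λ q x P s τ A J I →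
             let y = x :* P in
             :- (s :* τ) :* A :* J :* ((con 1ℤ :- q :^ 2 :* (y :* x)) :* I)
                 :- :- (:- s :* (τ :* (q :* x))) :* A :* ((con 1ℤ :- P) :* J) :* I
               := :- (s :* τ) :* ((con 1ℤ :+ q :* x) :* (con 1ℤ :- q :* y) :* A :* J :* I))
             refl q x P s τ A J I ⟩
      - (s * τ) * ((1# + q * x) * (1# - q * y) * A * J * I)
        ≈⟨ *-congˡ (*-congʳ (*-cong (*-congʳ (*-congˡ (+-congˡ (-‿cong (*-congˡ y≈))))) (reflexive (j-+₀ k r)))) ⟨
      - (s * τ) * ((1# + q * x) * (1# - q * q ^ m) * A * j m k * I) ∎
      where
      x P s τ A J I y : Carrier
      x = q ^ k
      P = q ^ r
      s = sgn k
      τ = q ^ triangular k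
      A = a m
      J = i r
      I = i (2 ℕ.+ (m ℕ.+ k))
      y = x * P

      y≈ : q ^ m ≈ y
      y≈ = ^-homo-* q k r

      i₁≈ : i (suc (m ℕ.+ k)) ≈ (1# - q ^ 2 * (y * x)) * I
      i₁≈ = trans (i-+₁ m k) (*-congʳ (+-congˡ (-‿cong (*-congˡ (*-congʳ y≈)))))

    -- Expansion of the finite products in symmetric functions of z.

    module Expansion (z z̄ : Carrier) (z*z̄≈1 : z * z̄ ≈ 1#) where

      -- `u⁻ k` stands for `u (k - 1)`. Since z^k + z^-k is even in k, the value at k = 0 is
      -- `- u 0`: the same antisymmetry as that of `d`.
      w u u⁻ v : ℕ → Carrier
      w k = z ^ k + z̄ ^ k
      u k = w (suc k) - w k
      u⁻ zero    = - u 0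
      u⁻ (suc k) = u k
      v k = w k - w 0

      w-step : ∀ k → (z + z̄) * w (suc k) ≈ w (suc (suc k)) + w k
      w-step k = begin
        (z + z̄) * (z * z ^ k + z̄ * z̄ ^ k)
          ≈⟨ solve 4 (λ z z̄ x y → (z :+ z̄) :* (z :* x :+ z̄ :* y)
               := z :* (z :* x) :+ z̄ :* (z̄ :* y) :+ (z :* z̄) :* (x :+ y)) refl z z̄ (z ^ k) (z̄ ^ k) ⟩
        w (suc (suc k)) + (z * z̄) * w k
          ≈⟨ +-congˡ (trans (*-congʳ z*z̄≈1) (*-identityˡ _)) ⟩
        w (suc (suc k)) + w k ∎

      u-step : ∀ k → (z + z̄) * u k ≈ u (suc k) + u⁻ k
      u-step zero = begin
        (z + z̄) * (w 1 - w 0)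
          ≈⟨ solve 4 (λ z z̄ w₁ w₀ → (z :+ z̄) :* (w₁ :- w₀) := (z :+ z̄) :* w₁ :- (z :+ z̄) :* w₀) refl z z̄ (w 1) (w 0) ⟩
        (z + z̄) * w 1 - (z + z̄) * w 0
          ≈⟨ +-congʳ (w-step 0) ⟩
        (w 2 + w 0) - (z + z̄) * w 0
          ≈⟨ solve 3 (λ z z̄ w₂ →
               let w₁ = z :* con 1ℤ :+ z̄ :* con 1ℤ
                   w₀ = con 1ℤ :+ con 1ℤ
               in (w₂ :+ w₀) :- (z :+ z̄) :* w₀ := (w₂ :- w₁) :+ :- (w₁ :- w₀)) refl z z̄ (w 2) ⟩
        u 1 + - u 0 ∎
      u-step (suc k) = begin
        (z + z̄) * (w (suc (suc k)) - w (suc k))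
          ≈⟨ solve 3 (λ x a b → x :* (a :- b) := x :* a :- x :* b) refl (z + z̄) (w (suc (suc k))) (w (suc k)) ⟩
        (z + z̄) * w (suc (suc k)) - (z + z̄) * w (suc k)
          ≈⟨ +-cong (w-step (suc k)) (-‿cong (w-step k)) ⟩
        (w (3 ℕ.+ k) + w (suc k)) - (w (suc (suc k)) + w k)
          ≈⟨ solve 4 (λ a b c d → (a :+ b) :- (c :+ d) := (a :- c) :+ (b :- d)) refl
               (w (3 ℕ.+ k)) (w (suc k)) (w (suc (suc k))) (w k) ⟩
        u (suc (suc k)) + u k ∎

      -- (z;q)_n (z⁻¹;q)_n
      Π : ℕ → Carrier
      Π zero    = 1#
      Π (suc n) = Π n * ((1# - z * q ^ n) * (1# - z̄ * q ^ n))

      -- By `u-step`, the new factor shifts the index of `u`. The discrete Wronskian `X` of `d` and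
      -- `u` moves these shifts onto `d` at the cost of a telescoping sum, and `d-suc` finishes.
      -- `X 0` vanishes by the two antisymmetries, the upper end because `d m n` does. A free bound
      -- `n` lets all m share one range later.
      Π-expansion : ∀ m n → m < n → Π (suc m) ≈ ∑ n (λ k → d m k * u k)
      Π-expansion zero (suc n) _ = begin
        1# * ((1# - z * 1#) * (1# - z̄ * 1#))
          ≈⟨ solve 2 (λ z z̄ → con 1ℤ :* ((con 1ℤ :- z :* con 1ℤ) :* (con 1ℤ :- z̄ :* con 1ℤ))
               := con 1ℤ :- z :- z̄ :+ z :* z̄) refl z z̄ ⟩
        1# - z - z̄ + z * z̄
          ≈⟨ +-congˡ z*z̄≈1 ⟩
        1# - z - z̄ + 1#
          ≈⟨ solve 2 (λ z z̄ → con 1ℤ :- z :- z̄ :+ con 1ℤ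
               := con 0ℤ :+ :- (con 1ℤ :* con 1ℤ) :* ((z :* con 1ℤ :+ z̄ :* con 1ℤ) :- (con 1ℤ :+ con 1ℤ))) refl z z̄ ⟩
        0# + - (1# * 1#) * u 0
          ≈⟨ +-congˡ (*-congʳ (sym d₀₀)) ⟩
        0# + d 0 0 * u 0
          ≈⟨ ∑-extend {1} (s≤s z≤n) (λ k 1≤k → trans (*-congʳ (d-zero 1≤k)) (zeroˡ _)) ⟨
        ∑ (suc n) (λ k → d 0 k * u k) ∎
        where
        d₀₀ : d 0 0 ≈ - (1# * 1#)
        d₀₀ = begin
          - (1# * 1#) * (1# - q) * i 0 * i 1
            ≈⟨ solve 3 (λ q i₀ i₁ → :- (con 1ℤ :* con 1ℤ) :* (con 1ℤ :- q) :* i₀ :* i₁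
                 := :- (i₀ :* ((con 1ℤ :- q :* con 1ℤ) :* i₁))) refl q (i 0) (i 1) ⟩
          - (i 0 * ((1# - q * 1#) * i 1))
            ≈⟨ -‿cong (*-cong i0≈1 (trans (sym (i-step 0)) i0≈1)) ⟩
          - (1# * 1#) ∎
      Π-expansion (suc m) (suc n) (s≤s m<n) = begin
        Π (suc m) * ((1# - z * (q * q ^ m)) * (1# - z̄ * (q * q ^ m)))
          ≈⟨ *-congˡ (trans
               (solve 4 (λ z z̄ q y → (con 1ℤ :- z :* (q :* y)) :* (con 1ℤ :- z̄ :* (q :* y))
                 := con 1ℤ :- q :* y :* (z :+ z̄) :+ z :* z̄ :* (q :^ 2 :* y :^ 2)) refl z z̄ q (q ^ m))
               (+-congˡ (*-congʳ z*z̄≈1))) ⟩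
        Π (suc m) * (1# - q * q ^ m * (z + z̄) + 1# * (q ^ 2 * (q ^ m) ^ 2))
          ≈⟨ *-congʳ (Π-expansion m (suc n) (ℕₚ.m<n⇒m<1+n m<n)) ⟩
        ∑ (suc n) (λ k → d m k * u k) * (1# - q * q ^ m * (z + z̄) + 1# * (q ^ 2 * (q ^ m) ^ 2))
          -- The inserted `0# - 0#` holds the place of the two ends of the telescoping sum of `X`.
          ≈⟨ solve 4 (λ s y² y zz → s :* (con 1ℤ :- y :* zz :+ con 1ℤ :* y²)
               := (con 1ℤ :+ y² :- y :* zz) :* s :+ y :* (con 0ℤ :- con 0ℤ)) refl
               (∑ (suc n) (λ k → d m k * u k)) (q ^ 2 * (q ^ m) ^ 2) (q * q ^ m) (z + z̄) ⟩
        p * ∑ (suc n) (λ k → d m k * u k) + q * q ^ m * (0# - 0#)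
          ≈⟨ +-congˡ (*-congˡ (+-cong X-last (-‿cong X-first))) ⟨
        p * ∑ (suc n) (λ k → d m k * u k) + q * q ^ m * (X (suc n) - X 0)
          ≈⟨ +-cong (∑-*ˡ (suc n) p _) (trans (∑-*ˡ (suc n) (q * q ^ m) _) (*-congˡ (∑-telescope (suc n) X))) ⟨
        ∑ (suc n) (λ k → p * (d m k * u k)) + ∑ (suc n) (λ k → q * q ^ m * (X (suc k) - X k))
          ≈⟨ ∑-+ (suc n) _ _ ⟨
        ∑ (suc n) (λ k → p * (d m k * u k) + q * q ^ m * (X (suc k) - X k))
          ≈⟨ ∑-cong (suc n) (λ k _ → summand k) ⟩
        ∑ (suc n) (λ k → d (suc m) k * u k) ∎
        where
        p : Carrier
        p = 1# + q ^ 2 * (q ^ m) ^ 2 - q * q ^ m * (z + z̄)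

        X : ℕ → Carrier
        X k = d⁻ m k * u k - d m k * u⁻ k

        X-first : X 0 ≈ 0#
        X-first = solve 2 (λ d u → :- d :* u :- d :* :- u := con 0ℤ) refl (d m 0) (u 0)

        X-last : X (suc n) ≈ 0#
        X-last = begin
          d m n * u (suc n) - d m (suc n) * u n
            ≈⟨ +-cong (*-congʳ (d-zero m<n)) (-‿cong (*-congʳ (d-zero (ℕₚ.m<n⇒m<1+n m<n)))) ⟩
          0# * u (suc n) - 0# * u n
            ≈⟨ solve 2 (λ x y → con 0ℤ :* x :- con 0ℤ :* y := con 0ℤ) refl (u (suc n)) (u n) ⟩
          0# ∎

        summand : ∀ k → p * (d m k * u k) + q * q ^ m * (X (suc k) - X k) ≈ d (suc m) k * u k
        summand k = begin
          p * (d m k * u k) + y * ((d m k * u (suc k) - d m (suc k) * u k) - (d⁻ m k * u k - d m k * u⁻ k))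
            ≈⟨ solve 9 (λ y² y zz d d⁻ d⁺ u u⁺ u⁻ →
                 (con 1ℤ :+ y² :- y :* zz) :* (d :* u) :+ y :* ((d :* u⁺ :- d⁺ :* u) :- (d⁻ :* u :- d :* u⁻))
                   := ((con 1ℤ :+ y²) :* d :- y :* (d⁻ :+ d⁺)) :* u :+ y :* d :* ((u⁺ :+ u⁻) :- zz :* u))
                 refl (q ^ 2 * (q ^ m) ^ 2) y (z + z̄) (d m k) (d⁻ m k) (d m (suc k)) (u k) (u (suc k)) (u⁻ k) ⟩
          ((1# + q ^ 2 * (q ^ m) ^ 2) * d m k - y * (d⁻ m k + d m (suc k))) * u k
              + y * d m k * ((u (suc k) + u⁻ k) - (z + z̄) * u k)
            ≈⟨ +-cong (*-congʳ (sym (d-suc m k))) (*-congˡ (trans (+-congˡ (-‿cong (u-step k))) (-‿inverseʳ _))) ⟩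
          d (suc m) k * u k + y * d m k * 0#
            ≈⟨ trans (+-congˡ (zeroʳ _)) (+-identityʳ _) ⟩
          d (suc m) k * u k ∎
          where
          y : Carrier
          y = q * q ^ m

      -- Here `u k` is `v (suc k) - v k`; the boundary terms vanish because `d m n` and `v 0` are 0.
      Π-expansion′ : ∀ m n → m < n → Π (suc m) ≈ ∑ n (λ k → (d m k - d m (suc k)) * v (suc k))
      Π-expansion′ m n m<n = begin
        Π (suc m)
          ≈⟨ Π-expansion m n m<n ⟩
        ∑ n (λ k → d m k * u k)
          ≈⟨ ∑-cong n (λ k _ → solve 5 (λ d d⁺ w⁺ w w₀ → d :* (w⁺ :- w)
               := (d :- d⁺) :* (w⁺ :- w₀) :+ (d⁺ :* (w⁺ :- w₀) :- d :* (w :- w₀))) refl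
               (d m k) (d m (suc k)) (w (suc k)) (w k) (w 0)) ⟩
        ∑ n (λ k → (d m k - d m (suc k)) * v (suc k) + (d m (suc k) * v (suc k) - d m k * v k))
          ≈⟨ trans (∑-+ n _ _) (+-congˡ (∑-telescope n (λ k → d m k * v k))) ⟩
        ∑ n (λ k → (d m k - d m (suc k)) * v (suc k)) + (d m n * v n - d m 0 * v 0)
          ≈⟨ +-congˡ (+-cong (*-congʳ (d-zero m<n)) (-‿cong (*-congˡ (-‿inverseʳ (w 0))))) ⟩
        ∑ n (λ k → (d m k - d m (suc k)) * v (suc k)) + (0# * v n - d m 0 * 0#)
          ≈⟨ solve 3 (λ s x y → s :+ (con 0ℤ :* x :- y :* con 0ℤ) := s) refl _ (v n) (d m 0) ⟩
        ∑ n (λ k → (d m k - d m (suc k)) * v (suc k)) ∎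

      -- All expansions of `Π (suc m)` are padded to the common range `D`, so the sums over m and k
      -- can be exchanged and `γ k` read off as the inner sum.
      hecke-expansion :
        e 1 * ∑ D (λ m → q ^ suc m * e (suc (suc m)) * Π (suc m))
          ≈ ∑ D (λ k → v (suc k) * - (sgn k * q ^ triangular k) * θ D k)
      hecke-expansion = begin
        e 1 * ∑ D (λ m → q ^ suc m * e (suc (suc m)) * Π (suc m))
          ≈⟨ *-congˡ (∑-cong D λ m m<D → trans (*-congˡ (Π-expansion′ m D m<D)) (sym (∑-*ˡ D _ _))) ⟩
        e 1 * ∑ D (λ m → ∑ D (λ k → q ^ suc m * e (suc (suc m)) * ((d m k - d m (suc k)) * v (suc k))))
          ≈⟨ *-congˡ (∑-swap D D _) ⟩
        e 1 * ∑ D (λ k → ∑ D (λ m → q ^ suc m * e (suc (suc m)) * ((d m k - d m (suc k)) * v (suc k))))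
          ≈⟨ ∑-*ˡ D (e 1) _ ⟨
        ∑ D (λ k → e 1 * ∑ D (λ m → q ^ suc m * e (suc (suc m)) * ((d m k - d m (suc k)) * v (suc k))))
          ≈⟨ ∑-cong D (λ k _ → *-congˡ (trans (∑-cong D (λ m _ → summand m k)) (∑-*ˡ D _ _))) ⟩
        ∑ D (λ k → e 1 * (v (suc k) * - (sgn k * q ^ triangular k) * ∑ D (λ m → t m k)))
          ≈⟨ ∑-cong D (λ k _ → solve 3 (λ e x s → e :* (x :* s) := x :* (e :* s)) refl
               (e 1) (v (suc k) * - (sgn k * q ^ triangular k)) (∑ D (λ m → t m k))) ⟩
        ∑ D (λ k → v (suc k) * - (sgn k * q ^ triangular k) * γ k)
          ≈⟨ ∑-cong D (λ k _ → *-congˡ (γ≈θ k)) ⟩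
        ∑ D (λ k → v (suc k) * - (sgn k * q ^ triangular k) * θ D k) ∎
        where
        summand : ∀ m k → q ^ suc m * e (suc (suc m)) * ((d m k - d m (suc k)) * v (suc k))
                            ≈ v (suc k) * - (sgn k * q ^ triangular k) * t m k
        summand m k = begin
          q ^ suc m * e (suc (suc m)) * ((d m k - d m (suc k)) * v (suc k))
            ≈⟨ *-congˡ (*-congʳ (d-difference m k)) ⟩
          q * q ^ m * e (suc (suc m))
            * (- (sgn k * q ^ triangular k) * ((1# + q * q ^ k) * (1# - q * q ^ m) * a m * j m k * i (suc (suc (m ℕ.+ k)))) * v (suc k))
            ≈⟨ solve 9 (λ y e s c b a j i v →
                 y :* e :* (s :* (c :* b :* a :* j :* i) :* v) := v :* s :* (y :* c :* a :* (b :* e) :* j :* i)) refl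
                 (q * q ^ m) (e (suc (suc m))) (- (sgn k * q ^ triangular k)) (1# + q * q ^ k) (1# - q * q ^ m)
                 (a m) (j m k) (i (suc (suc (m ℕ.+ k)))) (v (suc k)) ⟩
          v (suc k) * - (sgn k * q ^ triangular k)
            * (q * q ^ m * (1# + q * q ^ k) * a m * ((1# - q * q ^ m) * e (suc (suc m))) * j m k * i (suc (suc (m ℕ.+ k))))
            ≈⟨ *-congˡ (*-congʳ (*-congʳ (*-congˡ (e-step (suc m))))) ⟨
          v (suc k) * - (sgn k * q ^ triangular k) * t m k ∎

-- Ring laws for the Cauchy product.

module CauchyProduct {c ℓ} (R : CommutativeRing c ℓ) where

  private module R = CommutativeRing R
  open R using (Carrier; 0#; 1#)
  open PowerSeries R
  open Sums R
  open IntegerSolver R using (solve; _:=_; _:+_; _:*_; con)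
  open import Relation.Binary.Reasoning.Setoid R.setoid

  *-cong-≤ : ∀ {f f′ g g′} N → (∀ i → i ≤ N → f i R.≈ f′ i) → (∀ i → i ≤ N → g i R.≈ g′ i) →
    (f * g) N R.≈ (f′ * g′) N
  *-cong-≤ N f≈ g≈ = ∑-cong (suc N) λ i i≤N → R.*-cong (f≈ i (ℕ.s≤s⁻¹ i≤N)) (g≈ (N ∸ i) (ℕₚ.m∸n≤m N i))

  *-suc-head : ∀ f g n → (f * g) (suc n) R.≈ f 0 R.* g (suc n) R.+ ((f ∘ suc) * g) n
  *-suc-head f g n = ∑-head (suc n) _

  -- Splitting off the last term is the mirror image of `*-suc-head`; commutativity follows by
  -- playing one against the other.
  *-suc-last : ∀ f g n → (f * g) (suc n) R.≈ (f * (g ∘ suc)) n R.+ f (suc n) R.* g 0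
  *-suc-last f g n = R.+-cong
    (∑-cong (suc n) λ i i≤n → R.*-congˡ (R.reflexive (≡.cong g (ℕₚ.+-∸-assoc 1 (ℕ.s≤s⁻¹ i≤n)))))
    (R.*-congˡ (R.reflexive (≡.cong g (ℕₚ.n∸n≡0 n))))

  *-comm : ∀ f g N → (f * g) N R.≈ (g * f) N
  *-comm f g zero    = R.+-congˡ (R.*-comm _ _)
  *-comm f g (suc N) = begin
    (f * g) (suc N)                            ≈⟨ *-suc-head f g N ⟩
    f 0 R.* g (suc N) R.+ ((f ∘ suc) * g) N    ≈⟨ R.+-cong (R.*-comm _ _) (*-comm (f ∘ suc) g N) ⟩
    g (suc N) R.* f 0 R.+ (g * (f ∘ suc)) N    ≈⟨ R.+-comm _ _ ⟩
    (g * (f ∘ suc)) N R.+ g (suc N) R.* f 0    ≈⟨ *-suc-last g f N ⟨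
    (g * f) (suc N)                            ∎

  *-distribˡ-+ : ∀ f g h N → (f * (g + h)) N R.≈ (f * g + f * h) N
  *-distribˡ-+ f g h N = R.trans (∑-cong (suc N) λ _ _ → R.distribˡ _ _ _) (∑-+ (suc N) _ _)

  *-distribʳ-+ : ∀ f g h N → ((g + h) * f) N R.≈ (g * f + h * f) N
  *-distribʳ-+ f g h N = R.trans (∑-cong (suc N) λ _ _ → R.distribʳ _ _ _) (∑-+ (suc N) _ _)

  scale-* : ∀ a f g N → ((λ i → a R.* f i) * g) N R.≈ a R.* (f * g) N
  scale-* a f g N = R.trans (∑-cong (suc N) λ _ _ → R.*-assoc _ _ _) (∑-*ˡ (suc N) a _)

  *-assoc : ∀ f g h N → ((f * g) * h) N R.≈ (f * (g * h)) N
  *-assoc f g h zero    = solve 3 (λ x y z → con 0ℤ :+ (con 0ℤ :+ x :* y) :* z := con 0ℤ :+ x :* (con 0ℤ :+ y :* z)) R.refl (f 0) (g 0) (h 0)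
  *-assoc f g h (suc N) = begin
    ((f * g) * h) (suc N)
      ≈⟨ *-suc-head (f * g) h N ⟩
    (0# R.+ f 0 R.* g 0) R.* h (suc N) R.+ (((f * g) ∘ suc) * h) N
      ≈⟨ R.+-cong (R.*-congʳ (R.+-identityˡ _)) (begin
           (((f * g) ∘ suc) * h) N
             ≈⟨ *-cong-≤ {f = (f * g) ∘ suc} {g = h} N (λ i _ → *-suc-head f g i) (λ _ _ → R.refl) ⟩
           (((λ i → f 0 R.* g (suc i)) + (f ∘ suc) * g) * h) N
             ≈⟨ *-distribʳ-+ h (λ i → f 0 R.* g (suc i)) ((f ∘ suc) * g) N ⟩
           ((λ i → f 0 R.* g (suc i)) * h) N R.+ (((f ∘ suc) * g) * h) N
             ≈⟨ R.+-cong (scale-* (f 0) (g ∘ suc) h N) (*-assoc (f ∘ suc) g h N) ⟩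
           f 0 R.* ((g ∘ suc) * h) N R.+ ((f ∘ suc) * (g * h)) N ∎) ⟩
    f 0 R.* g 0 R.* h (suc N) R.+ (f 0 R.* ((g ∘ suc) * h) N R.+ ((f ∘ suc) * (g * h)) N)
      ≈⟨ solve 5 (λ x y z u w → x :* y :* z :+ (x :* u :+ w) := x :* (y :* z :+ u) :+ w) R.refl
           (f 0) (g 0) (h (suc N)) (((g ∘ suc) * h) N) (((f ∘ suc) * (g * h)) N) ⟩
    f 0 R.* (g 0 R.* h (suc N) R.+ ((g ∘ suc) * h) N) R.+ ((f ∘ suc) * (g * h)) N
      ≈⟨ R.+-congʳ (R.*-congˡ (*-suc-head g h N)) ⟨
    f 0 R.* (g * h) (suc N) R.+ ((f ∘ suc) * (g * h)) N
      ≈⟨ *-suc-head f (g * h) N ⟨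
    (f * (g * h)) (suc N) ∎

  C-* : ∀ a g N → (C a * g) N R.≈ a R.* g N
  C-* a g zero    = R.+-identityˡ _
  C-* a g (suc N) = R.trans (*-suc-head (C a) g N)
    (R.trans (R.+-congˡ (∑-zero (suc N) λ _ _ → R.zeroˡ _)) (R.+-identityʳ _))

  -- The tail of `monomial a (suc m)` is `monomial a m` by computation, as the boolean of
  -- `suc m ≟ suc N` reduces to that of `m ≟ N`.
  monomial-* : ∀ a b m n N → (monomial a m * monomial b n) N R.≈ monomial (a R.* b) (m ℕ.+ n) N
  monomial-* a b zero    n N = R.trans (C-* a (monomial b n) N) indicator
    where
    indicator : a R.* monomial b n N R.≈ monomial (a R.* b) n N
    indicator with does (n ℕₚ.≟ N)
    ... | true  = R.refl
    ... | false = R.zeroʳ a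
  monomial-* a b (suc m) n zero    = R.trans (R.+-identityˡ _) (R.zeroˡ _)
  monomial-* a b (suc m) n (suc N) = begin
    (monomial a (suc m) * monomial b n) (suc N)                       ≈⟨ *-suc-head (monomial a (suc m)) (monomial b n) N ⟩
    0# R.* monomial b n (suc N) R.+ (monomial a m * monomial b n) N   ≈⟨ R.+-cong (R.zeroˡ _) (monomial-* a b m n N) ⟩
    0# R.+ monomial (a R.* b) (m ℕ.+ n) N                             ≈⟨ R.+-identityˡ _ ⟩
    monomial (a R.* b) (m ℕ.+ n) N                                    ∎

  monomial-cong : ∀ {a b} n → a R.≈ b → ∀ N → monomial a n N R.≈ monomial b n N
  monomial-cong n a≈b N with does (n ℕₚ.≟ N)
  ... | true  = a≈b
  ... | false = R.refl

-- The ring of power series modulo q^K.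

module Truncated {c ℓ} (R : CommutativeRing c ℓ) (K : ℕ) where

  private module R = CommutativeRing R
  open R using (Carrier; 0#; 1#)
  open PowerSeries R
  open CauchyProduct R

  infix 4 _≋_

  -- The quotient keeps all series as representatives and coarsens only the equality. As a record it
  -- lets unification recover `f` and `g`.
  record _≋_ (f g : Series) : Set ℓ where
    constructor mk≋
    field at : ∀ N → N < K → f N R.≈ g N
  open _≋_ public

  exact : ∀ {f g} → f ≈ g → f ≋ g
  exact f≈g .at N _ = f≈g N

  commutativeRing : CommutativeRing c ℓ
  commutativeRing = record
    { Carrier = Series ; _≈_ = _≋_ ; _+_ = _+_ ; _*_ = _*_ ; -_ = λ f N → R.- f N ; 0# = 0ₛ ; 1# = 1ₛ
    ; isCommutativeRing = record
      { isRing = record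
        { +-isAbelianGroup = record
          { isGroup = record
            { isMonoid = record
              { isSemigroup = record
                { isMagma = record
                  { isEquivalence = record
                    { refl = mk≋ λ _ _ → R.refl
                    ; sym = λ f≋g → mk≋ λ N N<K → R.sym (f≋g .at N N<K)
                    ; trans = λ f≋g g≋h → mk≋ λ N N<K → R.trans (f≋g .at N N<K) (g≋h .at N N<K) }
                  ; ∙-cong = λ f≋ g≋ → mk≋ λ N N<K → R.+-cong (f≋ .at N N<K) (g≋ .at N N<K) }
                ; assoc = λ _ _ _ → mk≋ λ _ _ → R.+-assoc _ _ _ }
              ; identity = (λ _ → mk≋ λ _ _ → R.+-identityˡ _) , λ _ → mk≋ λ _ _ → R.+-identityʳ _ }
            ; inverse = (λ _ → mk≋ λ _ _ → R.-‿inverseˡ _) , λ _ → mk≋ λ _ _ → R.-‿inverseʳ _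
            ; ⁻¹-cong = λ f≋ → mk≋ λ N N<K → R.-‿cong (f≋ .at N N<K) }
          ; comm = λ _ _ → mk≋ λ _ _ → R.+-comm _ _ }
        -- Coefficient `N` of a product involves only coefficients up to `N`, all of them below `K`.
        ; *-cong = λ f≋ g≋ → mk≋ λ N N<K → *-cong-≤ N
            (λ i i≤N → f≋ .at i (ℕₚ.≤-<-trans i≤N N<K)) (λ i i≤N → g≋ .at i (ℕₚ.≤-<-trans i≤N N<K))
        ; *-assoc = λ f g h → exact (*-assoc f g h)
        ; *-identity = (λ f → exact (1ₛ-* f)) , λ f → exact λ N → R.trans (*-comm f 1ₛ N) (1ₛ-* f N)
        ; distrib = (λ f g h → exact (*-distribˡ-+ f g h)) , λ f g h → exact (*-distribʳ-+ f g h) }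
      ; *-comm = λ f g → exact (*-comm f g) }
    }
    where
    1ₛ-* : ∀ f → 1ₛ * f ≈ f
    1ₛ-* f N = R.trans (C-* 1# f N) (R.*-identityˡ _)

-- Infinite products as finite products modulo q^K.

module TruncatedProducts {c ℓ} (R : CommutativeRing c ℓ) (K : ℕ) where

  private
    module R = CommutativeRing R
    module T = CommutativeRing (Truncated.commutativeRing R K)
  open R using (Carrier; 1#)
  open PowerSeries R
  open CauchyProduct R using (monomial-*; monomial-cong)
  open Truncated R K
  open import Algebra.Properties.Semiring.Exp T.semiring using (_^_)
  open import Algebra.Properties.Ring T.ring using (-0#≈0#)
  open import Relation.Binary.Reasoning.Setoid T.setoid
  open Sums (Truncated.commutativeRing R K) using (∑)

  ∑<≡∑ : ∀ n f → ∑< n f ≡ ∑ n f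
  ∑<≡∑ zero    f = ≡.refl
  ∑<≡∑ (suc n) f = ≡.cong (_+ f n) (∑<≡∑ n f)

  lim≋ : ∀ {s} (conv : Convergent s) n → (∀ N → N < K → proj₁ (conv N) ≤ n) → lim s conv ≋ s n
  lim≋ conv n large .at N N<K = R.sym (proj₂ (conv N) n (large N N<K))

  monomial≋0 : ∀ a n → K ≤ n → monomial a n ≋ 0ₛ
  monomial≋0 a n K≤n .at N N<K = O-monomial a n N (ℕₚ.<-≤-trans N<K K≤n)

  q^≋ : ∀ n → q^ n ≋ q^ 1 ^ n
  q^≋ zero    = T.refl
  q^≋ (suc n) = begin
    q^ (suc n)               ≈⟨ exact (monomial-cong (suc n) (R.*-identityˡ 1#)) ⟨
    monomial (1# R.* 1#) (1 ℕ.+ n) ≈⟨ exact (monomial-* 1# 1# 1 n) ⟨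
    q^ 1 * q^ n              ≈⟨ T.*-congˡ {x = q^ 1} (q^≋ n) ⟩
    q^ 1 * q^ 1 ^ n          ∎

  monomial≋ : ∀ a n → monomial a n ≋ C a * q^ 1 ^ n
  monomial≋ a n = begin
    monomial a n            ≈⟨ exact (monomial-cong n (R.*-identityʳ a)) ⟨
    monomial (a R.* 1#) n   ≈⟨ exact (monomial-* a 1# 0 n) ⟨
    C a * q^ n              ≈⟨ T.*-congˡ {x = C a} (q^≋ n) ⟩
    C a * q^ 1 ^ n          ∎

  ∏<-cong : ∀ n {f g} → (∀ k → f k ≋ g k) → ∏< n f ≋ ∏< n g
  ∏<-cong zero    f≋g = T.refl
  ∏<-cong (suc n) f≋g = T.*-cong (∏<-cong n f≋g) (f≋g n)

  ∏<-head : ∀ n f → ∏< (suc n) f ≋ f 0 * ∏< n (f ∘ suc)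
  ∏<-head zero    f = T.*-comm 1ₛ (f 0)
  ∏<-head (suc n) f = T.trans (T.*-congʳ {x = f (suc n)} (∏<-head n f)) (T.*-assoc (f 0) (∏< n (f ∘ suc)) (f (suc n)))

  ∏<-one : ∀ n {f} → (∀ k → f k ≋ 1ₛ) → ∏< n f ≋ 1ₛ
  ∏<-one zero    f≋1 = T.refl
  ∏<-one (suc n) f≋1 = T.trans (T.*-cong (∏<-one n f≋1) (f≋1 n)) (T.*-identityˡ _)

  factor : Carrier → ℕ → ℕ → Series
  factor a n k = 1ₛ - monomial a n * q^ k

  pochhammer≋ : ∀ a n M → K ≤ M → ⟨ monomial a n ⨾q⟩∞ ≋ ∏< M (factor a n)
  pochhammer≋ a n M K≤M = lim≋ (pochhammer-multipliable (monomial a n)) M λ N N<K → ℕₚ.≤-trans N<K K≤M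

  -- A factor depends only on the total exponent of q, so the product for `n` shifted by one place
  -- is the product for `suc n`.
  factor-cong : ∀ a m k m′ k′ → m ℕ.+ k ≡ m′ ℕ.+ k′ → factor a m k ≋ factor a m′ k′
  factor-cong a m k m′ k′ eq = T.+-congˡ {x = 1ₛ} (T.-‿cong (begin
    monomial a m * q^ k                ≈⟨ exact (monomial-* a 1# m k) ⟩
    monomial (a R.* 1#) (m ℕ.+ k)      ≡⟨ ≡.cong (monomial (a R.* 1#)) eq ⟩
    monomial (a R.* 1#) (m′ ℕ.+ k′)    ≈⟨ exact (monomial-* a 1# m′ k′) ⟨
    monomial a m′ * q^ k′              ∎))

  pochhammer-step : ∀ a n →
    ⟨ monomial a n ⨾q⟩∞ ≋ (1ₛ - C a * q^ 1 ^ n) * ⟨ monomial a (suc n) ⨾q⟩∞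
  pochhammer-step a n = begin
    ⟨ monomial a n ⨾q⟩∞
      -- One factor beyond `K` is kept, so that exactly `K` remain after the first is split off.
      ≈⟨ pochhammer≋ a n (suc K) (ℕₚ.n≤1+n K) ⟩
    ∏< (suc K) (factor a n)
      ≈⟨ ∏<-head K (factor a n) ⟩
    factor a n 0 * ∏< K (factor a n ∘ suc)
      ≈⟨ T.*-cong
           (T.+-congˡ {x = 1ₛ} (T.-‿cong (T.trans (T.*-identityʳ (monomial a n)) (monomial≋ a n))))
           (T.trans (∏<-cong K λ k → factor-cong a n (suc k) (suc n) k (ℕₚ.+-suc n k))
             (T.sym (pochhammer≋ a (suc n) K ℕₚ.≤-refl))) ⟩
    (1ₛ - C a * q^ 1 ^ n) * ⟨ monomial a (suc n) ⨾q⟩∞ ∎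

  pochhammer-large : ∀ a n → K ≤ n → ⟨ monomial a n ⨾q⟩∞ ≋ 1ₛ
  pochhammer-large a n K≤n = T.trans (pochhammer≋ a n K ℕₚ.≤-refl) (∏<-one K λ k → begin
    1ₛ - monomial a n * q^ k   ≈⟨ T.+-congˡ {x = 1ₛ} (T.-‿cong (T.trans (T.*-congʳ {x = q^ k} (monomial≋0 a n K≤n)) (T.zeroˡ (q^ k)))) ⟩
    1ₛ - 0ₛ                    ≈⟨ T.+-congˡ {x = 1ₛ} -0#≈0# ⟩
    1ₛ + 0ₛ                    ≈⟨ T.+-identityʳ 1ₛ ⟩
    1ₛ                         ∎)

open import Defs
open L using (Laurent; z^)

-- Kronecker symbols and Hecke exponents on residue classes.

-- `(4 + n) % 4` computes to `n % 4`, so one abstraction settles both sides; the last clause only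
-- completes the case distinction.
χ₋₄-periodic : ∀ n → χ₋₄ (4 ℕ.+ n) ≡ χ₋₄ n
χ₋₄-periodic n with n % 4
... | 0 = ≡.refl
... | 1 = ≡.refl
... | 2 = ≡.refl
... | 3 = ≡.refl
... | suc (suc (suc (suc _))) = ≡.refl

χ₁₂-periodic : ∀ n → χ₁₂ (12 ℕ.+ n) ≡ χ₁₂ n
χ₁₂-periodic n with n % 12
... | 0  = ≡.refl
... | 1  = ≡.refl
... | 2  = ≡.refl
... | 3  = ≡.refl
... | 4  = ≡.refl
... | 5  = ≡.refl
... | 6  = ≡.refl
... | 7  = ≡.refl
... | 8  = ≡.refl
... | 9  = ≡.refl
... | 10 = ≡.refl
... | 11 = ≡.refl
... | suc (suc (suc (suc (suc (suc (suc (suc (suc (suc (suc (suc _))))))))))) = ≡.refl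

sign : ℕ → ℤ
sign zero          = 1ℤ
sign (suc zero)    = -1ℤ
sign (suc (suc n)) = sign n

χ₋₄-even : ∀ n → χ₋₄ (n ℕ.* 2) ≡ 0ℤ
χ₋₄-even zero          = ≡.refl
χ₋₄-even (suc zero)    = ≡.refl
χ₋₄-even (suc (suc n)) = ≡.trans (χ₋₄-periodic (n ℕ.* 2)) (χ₋₄-even n)

χ₋₄-odd : ∀ n → χ₋₄ (1 ℕ.+ n ℕ.* 2) ≡ sign n
χ₋₄-odd zero          = ≡.refl
χ₋₄-odd (suc zero)    = ≡.refl
χ₋₄-odd (suc (suc n)) = ≡.trans (χ₋₄-periodic (1 ℕ.+ n ℕ.* 2)) (χ₋₄-odd n)

-- The argument is 1 + 2(3l + h), and 3l + h has the parity of l + h. Two steps in l add 12, that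
-- is, three periods.
χ₋₄-1+6l+2h : ∀ l h → χ₋₄ (1 ℕ.+ l ℕ.* 6 ℕ.+ h ℕ.* 2) ≡ sign (l ℕ.+ h)
χ₋₄-1+6l+2h zero          h = χ₋₄-odd h
χ₋₄-1+6l+2h (suc zero)    h = ≡.trans (χ₋₄-periodic (3 ℕ.+ h ℕ.* 2)) (χ₋₄-odd (suc h))
χ₋₄-1+6l+2h (suc (suc l)) h = ≡.trans
  (χ₋₄-periodic (8 ℕ.+ n)) (≡.trans (χ₋₄-periodic (4 ℕ.+ n)) (≡.trans (χ₋₄-periodic n) (χ₋₄-1+6l+2h l h)))
  where
  n : ℕ
  n = 1 ℕ.+ l ℕ.* 6 ℕ.+ h ℕ.* 2

χ₁₂-1+6l : ∀ l → χ₁₂ (1 ℕ.+ l ℕ.* 6) ≡ sign l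
χ₁₂-1+6l zero          = ≡.refl
χ₁₂-1+6l (suc zero)    = ≡.refl
χ₁₂-1+6l (suc (suc l)) = ≡.trans (χ₁₂-periodic (1 ℕ.+ l ℕ.* 6)) (χ₁₂-1+6l l)

χ₁₂-5+6l : ∀ l → χ₁₂ (5 ℕ.+ l ℕ.* 6) ≡ sign (suc l)
χ₁₂-5+6l zero          = ≡.refl
χ₁₂-5+6l (suc zero)    = ≡.refl
χ₁₂-5+6l (suc (suc l)) = ≡.trans (χ₁₂-periodic (5 ℕ.+ l ℕ.* 6)) (χ₁₂-5+6l l)

-- Two steps in l make one full period 12, so the values at j and 6 + j decide all others.
χ₁₂-vanishes : ∀ j → χ₁₂ j ≡ 0ℤ → χ₁₂ (6 ℕ.+ j) ≡ 0ℤ → ∀ l → χ₁₂ (j ℕ.+ l ℕ.* 6) ≡ 0ℤ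
χ₁₂-vanishes j p₀ p₁ l = ≡.trans (≡.cong χ₁₂ (ℕₚ.+-comm j (l ℕ.* 6))) (go l)
  where
  go : ∀ l → χ₁₂ (l ℕ.* 6 ℕ.+ j) ≡ 0ℤ
  go zero          = p₀
  go (suc zero)    = p₁
  go (suc (suc l)) = ≡.trans (χ₁₂-periodic (l ℕ.* 6 ℕ.+ j)) (go l)

triangular-double : ∀ n → triangular n ℕ.* 2 ≡ n ℕ.* suc n
triangular-double zero    = ≡.refl
triangular-double (suc n) = ≡.trans (ℕₚ.*-distribʳ-+ 2 (triangular n) (suc n))
  (≡.trans (≡.cong (ℕ._+ suc n ℕ.* 2) (triangular-double n)) (step n))
  where
  step : ∀ n → n ℕ.* suc n ℕ.+ suc n ℕ.* 2 ≡ suc n ℕ.* suc (suc n)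
  step = ℕSolver.solve-∀

-- Stated without subtraction or division, the hypothesis lets each truncating operation in
-- `heckeExponent` be undone exactly.
heckeExponent-exact : ∀ n m E → 3 ℕ.* (n ℕ.* n) ≡ m ℕ.* m ℕ.+ suc (E ℕ.* 12) ℕ.* 2 → heckeExponent n m ≡ E
heckeExponent-exact n m E eq = ≡.trans
  (≡.cong (λ x → (x / 2 ∸ 1) / 12) (≡.trans (≡.cong (_∸ m ℕ.* m) eq) (ℕₚ.m+n∸m≡n (m ℕ.* m) _)))
  (≡.trans (≡.cong (λ x → (x ∸ 1) / 12) (m*n/n≡m (suc (E ℕ.* 12)) 2)) (m*n/n≡m E 12))

exponent₁ exponent₅ : ℕ → ℕ → ℕ
exponent₁ l h = 3 ℕ.* (l ℕ.* l) ℕ.+ l ℕ.+ 3 ℕ.* (l ℕ.* h) ℕ.+ triangular h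
exponent₅ l h = exponent₁ l h ℕ.+ (4 ℕ.* l ℕ.+ 2 ℕ.* suc h)

-- Squaring produces h(h+1), whereas the exponent contains `triangular h`, which the solver cannot
-- expand. `before` and `after` are the solver identities on the two sides of that substitution, and
-- `polynomial` marks its place.
heckeExponent₁ : ∀ l h →
  heckeExponent (1 ℕ.+ l ℕ.* 6 ℕ.+ h ℕ.* 2) (1 ℕ.+ l ℕ.* 6) ≡ exponent₁ l h
heckeExponent₁ l h = heckeExponent-exact (1 ℕ.+ l ℕ.* 6 ℕ.+ h ℕ.* 2) (1 ℕ.+ l ℕ.* 6) _
  (≡.trans (before l h)
    (≡.trans (≡.cong (polynomial l h) (≡.sym (triangular-double h))) (after l h (triangular h))))
  where
  polynomial : ℕ → ℕ → ℕ → ℕ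
  polynomial l h s =
    (1 ℕ.+ l ℕ.* 6) ℕ.* (1 ℕ.+ l ℕ.* 6)
      ℕ.+ (suc ((3 ℕ.* (l ℕ.* l) ℕ.+ l ℕ.+ 3 ℕ.* (l ℕ.* h)) ℕ.* 12) ℕ.* 2 ℕ.+ s ℕ.* 12)

  before : ∀ l h →
    3 ℕ.* ((1 ℕ.+ l ℕ.* 6 ℕ.+ h ℕ.* 2) ℕ.* (1 ℕ.+ l ℕ.* 6 ℕ.+ h ℕ.* 2))
      ≡ (1 ℕ.+ l ℕ.* 6) ℕ.* (1 ℕ.+ l ℕ.* 6)
        ℕ.+ (suc ((3 ℕ.* (l ℕ.* l) ℕ.+ l ℕ.+ 3 ℕ.* (l ℕ.* h)) ℕ.* 12) ℕ.* 2
              ℕ.+ h ℕ.* suc h ℕ.* 12)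
  before = ℕSolver.solve-∀

  after : ∀ l h T →
    (1 ℕ.+ l ℕ.* 6) ℕ.* (1 ℕ.+ l ℕ.* 6)
      ℕ.+ (suc ((3 ℕ.* (l ℕ.* l) ℕ.+ l ℕ.+ 3 ℕ.* (l ℕ.* h)) ℕ.* 12) ℕ.* 2
            ℕ.+ T ℕ.* 2 ℕ.* 12)
      ≡ (1 ℕ.+ l ℕ.* 6) ℕ.* (1 ℕ.+ l ℕ.* 6)
        ℕ.+ suc ((3 ℕ.* (l ℕ.* l) ℕ.+ l ℕ.+ 3 ℕ.* (l ℕ.* h) ℕ.+ T) ℕ.* 12) ℕ.* 2
  after = ℕSolver.solve-∀

heckeExponent₅ : ∀ l h →
  heckeExponent (5 ℕ.+ l ℕ.* 6 ℕ.+ h ℕ.* 2) (5 ℕ.+ l ℕ.* 6) ≡ exponent₅ l h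
heckeExponent₅ l h = heckeExponent-exact (5 ℕ.+ l ℕ.* 6 ℕ.+ h ℕ.* 2) (5 ℕ.+ l ℕ.* 6) _
  (≡.trans (before l h)
    (≡.trans (≡.cong (polynomial l h) (≡.sym (triangular-double h))) (after l h (triangular h))))
  where
  polynomial : ℕ → ℕ → ℕ → ℕ
  polynomial l h s =
    (5 ℕ.+ l ℕ.* 6) ℕ.* (5 ℕ.+ l ℕ.* 6)
      ℕ.+ (suc ((3 ℕ.* (l ℕ.* l) ℕ.+ l ℕ.+ 3 ℕ.* (l ℕ.* h) ℕ.+ (4 ℕ.* l ℕ.+ 2 ℕ.* suc h)) ℕ.* 12) ℕ.* 2 ℕ.+ s ℕ.* 12)

  before : ∀ l h →
    3 ℕ.* ((5 ℕ.+ l ℕ.* 6 ℕ.+ h ℕ.* 2) ℕ.* (5 ℕ.+ l ℕ.* 6 ℕ.+ h ℕ.* 2))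
      ≡ (5 ℕ.+ l ℕ.* 6) ℕ.* (5 ℕ.+ l ℕ.* 6)
        ℕ.+ (suc ((3 ℕ.* (l ℕ.* l) ℕ.+ l ℕ.+ 3 ℕ.* (l ℕ.* h) ℕ.+ (4 ℕ.* l ℕ.+ 2 ℕ.* suc h)) ℕ.* 12) ℕ.* 2
              ℕ.+ h ℕ.* suc h ℕ.* 12)
  before = ℕSolver.solve-∀

  after : ∀ l h T →
    (5 ℕ.+ l ℕ.* 6) ℕ.* (5 ℕ.+ l ℕ.* 6)
      ℕ.+ (suc ((3 ℕ.* (l ℕ.* l) ℕ.+ l ℕ.+ 3 ℕ.* (l ℕ.* h) ℕ.+ (4 ℕ.* l ℕ.+ 2 ℕ.* suc h)) ℕ.* 12) ℕ.* 2
            ℕ.+ T ℕ.* 2 ℕ.* 12)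
      ≡ (5 ℕ.+ l ℕ.* 6) ℕ.* (5 ℕ.+ l ℕ.* 6)
        ℕ.+ suc ((3 ℕ.* (l ℕ.* l) ℕ.+ l ℕ.+ 3 ℕ.* (l ℕ.* h) ℕ.+ T ℕ.+ (4 ℕ.* l ℕ.+ 2 ℕ.* suc h)) ℕ.* 12) ℕ.* 2
  after = ℕSolver.solve-∀

exponent₁-suc : ∀ l k → exponent₁ l (suc k) ≡ triangular k ℕ.+ α l k
exponent₁-suc l k = expanded (3 ℕ.* (l ℕ.* l) ℕ.+ l ℕ.+ 3 ℕ.* (l ℕ.* suc k)) (triangular k) (suc k)
  where
  expanded : ∀ x y w → x ℕ.+ (y ℕ.+ w) ≡ y ℕ.+ (x ℕ.+ w)
  expanded = ℕSolver.solve-∀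

exponent₅-suc : ∀ l k → exponent₅ l (suc k) ≡ triangular k ℕ.+ β l k
exponent₅-suc l k = ≡.trans
  (≡.cong (ℕ._+ (4 ℕ.* l ℕ.+ 2 ℕ.* suc (suc k))) (exponent₁-suc l k))
  (ℕₚ.+-assoc (triangular k) (α l k) _)

half : ∀ m h → (m ℕ.+ h ℕ.* 2 ∸ m) / 2 ≡ h
half m h = ≡.trans (≡.cong (_/ 2) (ℕₚ.m+n∸m≡n m (h ℕ.* 2))) (m*n/n≡m h 2)

heckeCoefficient-zero : ∀ n m → χ₋₄ n ≡ 0ℤ ⊎ χ₁₂ m ≡ 0ℤ → heckeCoefficient n m L.≈ L.0#
heckeCoefficient-zero n m χ≡0 = vanish χ≡0
  where
  open CommutativeRing L.commutativeRing using (trans; *-congˡ; *-congʳ; zeroˡ; zeroʳ)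

  const-zero : L.const 0ℤ L.≈ L.0#
  const-zero = L.mk≈ λ k → zero-coefficient k
    where
    zero-coefficient : ∀ k → L.coeff (L.const 0ℤ) k ≡ 0ℤ
    zero-coefficient (+ zero)  = ≡.refl
    zero-coefficient (+ suc _) = ≡.refl
    zero-coefficient -[1+ _ ]  = ≡.refl

  X : Laurent
  X = (L.1# L.+ L.- z^ (+ ((n ∸ m) / 2))) L.* (L.1# L.+ L.- z^ (+ ((n ∸ m) / 2))) L.* z^ (ℤ.- + ((n ∸ m) / 2))

  vanish : χ₋₄ n ≡ 0ℤ ⊎ χ₁₂ m ≡ 0ℤ → X L.* L.const (χ₋₄ n) L.* L.const (χ₁₂ m) L.≈ L.0#
  vanish (inj₁ χ≡0) rewrite χ≡0 = trans (*-congʳ {x = L.const (χ₁₂ m)} (trans (*-congˡ {x = X} const-zero) (zeroʳ X))) (zeroˡ (L.const (χ₁₂ m)))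
  vanish (inj₂ χ≡0) rewrite χ≡0 = trans (*-congˡ {x = X L.* L.const (χ₋₄ n)} const-zero) (zeroʳ (X L.* L.const (χ₋₄ n)))

-- `heckeCoefficient` with h and both characters left free, so that their computed values can be
-- inserted.
coefficient : ℕ → ℤ → ℤ → Laurent
coefficient h c c′ =
  (L.1# L.+ L.- z^ (+ h)) L.* (L.1# L.+ L.- z^ (+ h)) L.* z^ (ℤ.- + h) L.* L.const c L.* L.const c′

-- Comparison of the coefficients of q^N.

module Coefficient (N : ℕ) where

  -- `D` is the threshold of `heckeExponent-large`: from n = D on, Hecke exponents exceed `N`. Since
  -- `K ≤ D`, it also serves as the cutoff of the q-series identity, and both sides get the same
  -- range.
  K D : ℕ
  K = suc N
  D = suc (suc N ℕ.* 12)

  K≤D : K ≤ D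
  K≤D = ℕₚ.≤-trans (ℕₚ.m≤m*n (suc N) 12) (ℕₚ.n≤1+n _)

  ring : CommutativeRing _ _
  ring = Truncated.commutativeRing L.commutativeRing K

  private module T = CommutativeRing ring

  open CauchyProduct L.commutativeRing using (monomial-*; monomial-cong)
  open Truncated L.commutativeRing K using (_≋_; mk≋; at; exact)
  open TruncatedProducts L.commutativeRing K
  open import Algebra.Properties.Semiring.Exp T.semiring using (_^_; ^-homo-*)
  open import Relation.Binary.Reasoning.Setoid T.setoid
  open IntegerSolver ring using (solve; _:=_; _:+_; _:*_; _:-_; :-_; con)
  open Sums ring

  q ζ ζ̄ : Series
  q = q^ 1
  ζ = C (z^ 1ℤ)
  ζ̄ = C (z^ -1ℤ)

  e : ℕ → Series
  e n = ⟨ q^ n ⨾q⟩∞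

  e-step : ∀ n → e n ≋ (1ₛ - q ^ n) * e (suc n)
  e-step n = T.trans (pochhammer-step L.1# n)
    (T.*-congʳ {x = e (suc n)} (T.+-congˡ {x = 1ₛ} (T.-‿cong (T.*-identityˡ (q ^ n)))))

  e-large : ∀ n → D ≤ n → e n ≋ 1ₛ
  e-large n D≤n = pochhammer-large L.1# n (ℕₚ.≤-trans K≤D D≤n)

  q^large≋0 : ∀ n → K ≤ n → q ^ n ≋ 0ₛ
  q^large≋0 n K≤n = T.trans (T.sym (q^≋ n)) (monomial≋0 L.1# n K≤n)

  q^D≋0 : q ^ D ≋ 0ₛ
  q^D≋0 = q^large≋0 D K≤D

  e⁻¹ : Series
  e⁻¹ = inv (e 1) (pochhammer-constantTerm (q^ 1) L.≈-refl)

  e-inverse : e 1 * e⁻¹ ≋ 1ₛ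
  e-inverse = exact (*-inverseʳ (e 1) (pochhammer-constantTerm (q^ 1) L.≈-refl))

  ζ*ζ̄≋1 : ζ * ζ̄ ≋ 1ₛ
  ζ*ζ̄≋1 = exact (monomial-* (z^ 1ℤ) (z^ -1ℤ) 0 0)

  open EulerProducts.Identity ring q D q^D≋0 e e-step e-large e⁻¹ e-inverse
    using (sgn; sgn-cancel; θ; module Expansion)
  open Expansion ζ ζ̄ ζ*ζ̄≋1 using (w; v; Π; hecke-expansion)

  denominator-step : ∀ n →
    sptDenominator n ≋ ((1ₛ - ζ * q ^ n) * (1ₛ - ζ̄ * q ^ n)) * sptDenominator (suc n)
  denominator-step n = T.trans
    (T.*-cong (pochhammer-step (z^ 1ℤ) n) (pochhammer-step (z^ -1ℤ) n))
    (solve 4 (λ a b c d → (a :* b) :* (c :* d) := (a :* c) :* (b :* d)) T.refl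
      (1ₛ - ζ * q ^ n) ⟨ monomial (z^ 1ℤ) (suc n) ⨾q⟩∞ (1ₛ - ζ̄ * q ^ n) ⟨ monomial (z^ -1ℤ) (suc n) ⨾q⟩∞)

  -- Both products are cut after `n` factors. For n ≥ 1 the tail has constant term 1 and cancels
  -- against its inverse in `sptSummand`; the head `Π n` stays as a numerator.
  denominator-Π : ∀ n → sptDenominator 0 ≋ Π n * sptDenominator n
  denominator-Π zero    = T.sym (T.*-identityˡ (sptDenominator 0))
  denominator-Π (suc n) = begin
    sptDenominator 0
      ≈⟨ denominator-Π n ⟩
    Π n * sptDenominator n
      ≈⟨ T.*-congˡ {x = Π n} (denominator-step n) ⟩
    Π n * (((1ₛ - ζ * q ^ n) * (1ₛ - ζ̄ * q ^ n)) * sptDenominator (suc n))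
      ≈⟨ T.*-assoc (Π n) ((1ₛ - ζ * q ^ n) * (1ₛ - ζ̄ * q ^ n)) (sptDenominator (suc n)) ⟨
    Π (suc n) * sptDenominator (suc n) ∎

  S≋ : S ≋ ∑ D sptSummand
  S≋ = T.trans (lim≋ sptSummand-summable D (λ M M<K → ℕₚ.≤-trans (ℕₚ.<⇒≤ M<K) K≤D)) (T.reflexive (∑<≡∑ D sptSummand))

  sptSummand≋ : ∀ n →
    sptDenominator 0 * sptSummand n ≋ q ^ suc n * e (suc (suc n)) * Π (suc n)
  sptSummand≋ n = begin
    sptDenominator 0 * (q^ (suc n) * (e (suc (suc n)) * 1/Y))
      ≈⟨ T.*-cong (denominator-Π (suc n)) (T.*-congʳ {x = e (suc (suc n)) * 1/Y} (q^≋ (suc n))) ⟩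
    (Π (suc n) * Y) * (q ^ suc n * (e (suc (suc n)) * 1/Y))
      ≈⟨ solve 5 (λ p y q e i → (p :* y) :* (q :* (e :* i)) := q :* e :* p :* (y :* i)) T.refl
           (Π (suc n)) Y (q ^ suc n) (e (suc (suc n))) 1/Y ⟩
    q ^ suc n * e (suc (suc n)) * Π (suc n) * (Y * 1/Y)
      ≈⟨ T.*-congˡ {x = q ^ suc n * e (suc (suc n)) * Π (suc n)} (exact (*-inverseʳ Y (sptDenominator-constantTerm n))) ⟩
    q ^ suc n * e (suc (suc n)) * Π (suc n) * 1ₛ
      ≈⟨ T.*-identityʳ (q ^ suc n * e (suc (suc n)) * Π (suc n)) ⟩
    q ^ suc n * e (suc (suc n)) * Π (suc n) ∎
    where
    Y 1/Y : Series
    Y   = sptDenominator (suc n)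
    1/Y = inv Y (sptDenominator-constantTerm n)

  product-side : ⟨ C (L.z^ 1ℤ) ⨾q⟩∞ * ⟨ C (L.z^ -1ℤ) ⨾q⟩∞ * ⟨ q^ 1 ⨾q⟩∞ * S
    ≋ ∑ D (λ k → v (suc k) * T.- (sgn k * q ^ triangular k) * θ D k)
  product-side = begin
    -- `C a` is `monomial a 0` by definition, so the two products in z already form
    -- `sptDenominator 0`.
    sptDenominator 0 * e 1 * S
      ≈⟨ T.*-congˡ {x = sptDenominator 0 * e 1} S≋ ⟩
    sptDenominator 0 * e 1 * ∑ D sptSummand
      ≈⟨ solve 3 (λ y e s → y :* e :* s := e :* (y :* s)) T.refl (sptDenominator 0) (e 1) (∑ D sptSummand) ⟩
    e 1 * (sptDenominator 0 * ∑ D sptSummand)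
      ≈⟨ T.*-congˡ {x = e 1} (T.trans (T.sym (∑-*ˡ D (sptDenominator 0) sptSummand)) (∑-cong D (λ n _ → sptSummand≋ n))) ⟩
    e 1 * ∑ D (λ n → q ^ suc n * e (suc (suc n)) * Π (suc n))
      ≈⟨ hecke-expansion ⟩
    ∑ D (λ k → v (suc k) * T.- (sgn k * q ^ triangular k) * θ D k) ∎

  C-cong : ∀ {a b} → a L.≈ b → C a ≋ C b
  C-cong a≈b = exact (monomial-cong 0 a≈b)

  C-* : ∀ a b → C (a L.* b) ≋ C a * C b
  C-* a b = T.sym (exact (monomial-* a b 0 0))

  C-+ : ∀ a b → C (a L.+ b) ≋ C a + C b
  C-+ a b .at zero    _ = L.≈-refl
  C-+ a b .at (suc _) _ = L.≈-refl

  C-neg : ∀ a → C (L.- a) ≋ T.- C a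
  C-neg a .at zero    _ = L.≈-refl
  C-neg a .at (suc _) _ = L.≈-refl

  C-0 : C L.0# ≋ 0ₛ
  C-0 .at zero    _ = L.≈-refl
  C-0 .at (suc _) _ = L.≈-refl

  C-z^ : ∀ h → C (z^ (+ h)) ≋ ζ ^ h
  C-z^ zero    = T.refl
  C-z^ (suc h) = T.trans (C-* (z^ 1ℤ) (z^ (+ h))) (T.*-congˡ {x = ζ} (C-z^ h))

  C-z^-neg : ∀ h → C (z^ (ℤ.- + h)) ≋ ζ̄ ^ h
  C-z^-neg zero          = T.refl
  C-z^-neg (suc zero)    = T.trans (C-* (z^ -1ℤ) (z^ 0ℤ)) (T.*-congˡ {x = ζ̄} (T.refl {x = 1ₛ}))
  C-z^-neg (suc (suc h)) = T.trans (C-* (z^ -1ℤ) (z^ -[1+ h ])) (T.*-congˡ {x = ζ̄} (C-z^-neg (suc h)))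

  ζ^*ζ̄^≋1 : ∀ h → ζ ^ h * ζ̄ ^ h ≋ 1ₛ
  ζ^*ζ̄^≋1 zero    = T.*-identityˡ 1ₛ
  ζ^*ζ̄^≋1 (suc h) = begin
    (ζ * ζ ^ h) * (ζ̄ * ζ̄ ^ h)
      ≈⟨ solve 4 (λ a b c d → (a :* b) :* (c :* d) := (a :* c) :* (b :* d)) T.refl ζ (ζ ^ h) ζ̄ (ζ̄ ^ h) ⟩
    (ζ * ζ̄) * (ζ ^ h * ζ̄ ^ h)
      ≈⟨ T.*-cong ζ*ζ̄≋1 (ζ^*ζ̄^≋1 h) ⟩
    1ₛ * 1ₛ
      ≈⟨ T.*-identityˡ 1ₛ ⟩
    1ₛ ∎

  C-sign : ∀ n → C (L.const (sign n)) ≋ sgn n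
  C-sign zero          = T.refl
  C-sign (suc zero)    = C-neg L.1#
  C-sign (suc (suc n)) = T.trans (C-sign n) (solve 1 (λ x → x := :- :- x) T.refl (sgn n))

  C-coefficient : ∀ h i j → C (coefficient h (sign i) (sign j)) ≋ v h * (sgn i * sgn j)
  C-coefficient h i j = begin
    C (1-z^h L.* 1-z^h L.* z^ (ℤ.- + h) L.* L.const (sign i) L.* L.const (sign j))
      ≈⟨ T.trans (C-* (1-z^h L.* 1-z^h L.* z^ (ℤ.- + h) L.* L.const (sign i)) (L.const (sign j)))
           (T.*-cong (T.trans (C-* (1-z^h L.* 1-z^h L.* z^ (ℤ.- + h)) (L.const (sign i)))
             (T.*-cong (T.trans (C-* (1-z^h L.* 1-z^h) (z^ (ℤ.- + h)))
               (T.*-cong (T.trans (C-* 1-z^h 1-z^h) (T.*-cong C-1-z^h C-1-z^h)) (C-z^-neg h))) (C-sign i))) (C-sign j)) ⟩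
    (1ₛ + T.- X) * (1ₛ + T.- X) * X̄ * sgn i * sgn j
      -- Each `x :* x̄` is isolated, since the solver does not know that it equals 1; `XX̄≋1`
      -- replaces it next.
      ≈⟨ solve 4 (λ x x̄ s t → (con 1ℤ :- x) :* (con 1ℤ :- x) :* x̄ :* s :* t
           := (x̄ :- (x :* x̄) :- (x :* x̄) :+ x :* (x :* x̄)) :* (s :* t)) T.refl X X̄ (sgn i) (sgn j) ⟩
    (X̄ + T.- (X * X̄) + T.- (X * X̄) + X * (X * X̄)) * (sgn i * sgn j)
      ≈⟨ T.*-congʳ {x = sgn i * sgn j} (T.+-cong (T.+-cong (T.+-congˡ {x = X̄} (T.-‿cong XX̄≋1)) (T.-‿cong XX̄≋1)) (T.*-congˡ {x = X} XX̄≋1)) ⟩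
    (X̄ + T.- 1ₛ + T.- 1ₛ + X * 1ₛ) * (sgn i * sgn j)
      ≈⟨ solve 4 (λ x x̄ s t → (x̄ :- con 1ℤ :- con 1ℤ :+ x :* con 1ℤ) :* (s :* t)
           := ((x :+ x̄) :- (con 1ℤ :+ con 1ℤ)) :* (s :* t)) T.refl X X̄ (sgn i) (sgn j) ⟩
    v h * (sgn i * sgn j) ∎
    where
    1-z^h : Laurent
    1-z^h = L.1# L.+ L.- z^ (+ h)

    X X̄ : Series
    X = ζ ^ h
    X̄ = ζ̄ ^ h

    XX̄≋1 : X * X̄ ≋ 1ₛ
    XX̄≋1 = ζ^*ζ̄^≋1 h

    C-1-z^h : C 1-z^h ≋ 1ₛ + T.- X
    C-1-z^h = T.trans (C-+ L.1# (L.- z^ (+ h))) (T.+-congˡ {x = 1ₛ} (T.trans (C-neg (z^ (+ h))) (T.-‿cong (C-z^ h))))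

  heckeSummand-exact : ∀ n m {h c c′ E} →
    (n ∸ m) / 2 ≡ h → χ₋₄ n ≡ c → χ₁₂ m ≡ c′ → heckeExponent n m ≡ E →
    heckeSummand n m ≋ C (coefficient h c c′) * q ^ E
  heckeSummand-exact n m ≡.refl ≡.refl ≡.refl ≡.refl = monomial≋ (heckeCoefficient n m) (heckeExponent n m)

  heckeSummand₁ : ∀ l h →
    heckeSummand (1 ℕ.+ l ℕ.* 6 ℕ.+ h ℕ.* 2) (1 ℕ.+ l ℕ.* 6) ≋ v h * sgn h * q ^ exponent₁ l h
  heckeSummand₁ l h = T.trans
    (heckeSummand-exact (1 ℕ.+ l ℕ.* 6 ℕ.+ h ℕ.* 2) (1 ℕ.+ l ℕ.* 6)
      (half (1 ℕ.+ l ℕ.* 6) h) (χ₋₄-1+6l+2h l h) (χ₁₂-1+6l l) (heckeExponent₁ l h))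
    (T.*-congʳ {x = q ^ exponent₁ l h} (T.trans (C-coefficient h (l ℕ.+ h) l) (T.*-congˡ {x = v h} (sgn-cancel l h))))

  heckeSummand₅ : ∀ l h →
    heckeSummand (5 ℕ.+ l ℕ.* 6 ℕ.+ h ℕ.* 2) (5 ℕ.+ l ℕ.* 6) ≋ v h * T.- sgn h * q ^ exponent₅ l h
  heckeSummand₅ l h = T.trans
    (heckeSummand-exact (5 ℕ.+ l ℕ.* 6 ℕ.+ h ℕ.* 2) (5 ℕ.+ l ℕ.* 6)
      (half (5 ℕ.+ l ℕ.* 6) h)
      (≡.trans (χ₋₄-periodic (1 ℕ.+ l ℕ.* 6 ℕ.+ h ℕ.* 2)) (χ₋₄-1+6l+2h l h))
      (χ₁₂-5+6l l) (heckeExponent₅ l h))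
    (T.*-congʳ {x = q ^ exponent₅ l h} (T.trans (C-coefficient h (l ℕ.+ h) (suc l)) (T.*-congˡ {x = v h} (T.trans
      (solve 2 (λ x y → x :* :- y := :- (x :* y)) T.refl (sgn (l ℕ.+ h)) (sgn l)) (T.-‿cong (sgn-cancel l h))))))

  heckeSummand-zero : ∀ n m → χ₋₄ n ≡ 0ℤ ⊎ χ₁₂ m ≡ 0ℤ → heckeSummand n m ≋ 0ₛ
  heckeSummand-zero n m χ≡0 = begin
    heckeSummand n m                              ≈⟨ monomial≋ (heckeCoefficient n m) E ⟩
    C (heckeCoefficient n m) * q ^ E              ≈⟨ T.*-congʳ {x = q ^ E} (T.trans (C-cong (heckeCoefficient-zero n m χ≡0)) C-0) ⟩
    0ₛ * q ^ E                                    ≈⟨ T.zeroˡ (q ^ E) ⟩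
    0ₛ                                            ∎
    where
    E : ℕ
    E = heckeExponent n m

  heckeSummand-large : ∀ n m → D ≤ n → m ≤ n → heckeSummand n m ≋ 0ₛ
  heckeSummand-large n m D≤n m≤n = monomial≋0 (heckeCoefficient n m) (heckeExponent n m) (heckeExponent-large N n m D≤n m≤n)

  -- The summands with fixed m = j + 6l, sorted by d = n - m.
  row : ℕ → ℕ → Series
  row j l = ∑ (suc D ℕ.* 2) (λ d → heckeSummand (j ℕ.+ l ℕ.* 6 ℕ.+ d) (j ℕ.+ l ℕ.* 6))

  row-zero : ∀ j → χ₁₂ j ≡ 0ℤ → χ₁₂ (6 ℕ.+ j) ≡ 0ℤ → ∀ l → row j l ≋ 0ₛ
  row-zero j p₀ p₁ l = ∑-zero (suc D ℕ.* 2) λ d _ →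
    heckeSummand-zero (j ℕ.+ l ℕ.* 6 ℕ.+ d) (j ℕ.+ l ℕ.* 6) (inj₂ (χ₁₂-vanishes j p₀ p₁ l))

  -- Odd d contribute nothing, and h = 0 drops out because `v 0` is 0. The row width `suc D * 2`
  -- leaves exactly the `D` terms h = 1, ..., D.
  row-odd : ∀ j l (f : ℕ → Series) →
    (∀ h → χ₋₄ (j ℕ.+ l ℕ.* 6 ℕ.+ (1 ℕ.+ h ℕ.* 2)) ≡ 0ℤ) →
    (∀ h → heckeSummand (j ℕ.+ l ℕ.* 6 ℕ.+ h ℕ.* 2) (j ℕ.+ l ℕ.* 6) ≋ v h * f h) →
    row j l ≋ ∑ D (λ k → v (suc k) * f (suc k))
  row-odd j l f odd-vanishes even≋ = begin
    ∑ (suc D ℕ.* 2) H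
      ≈⟨ ∑-blocks (suc D) 2 H ⟩
    ∑ (suc D) (λ h → ∑ 2 (λ b → H (b ℕ.+ h ℕ.* 2)))
      ≈⟨ ∑-cong (suc D) (λ h _ → T.trans
           (T.+-cong (T.+-congˡ {x = 0ₛ} (even≋ h)) (heckeSummand-zero (m ℕ.+ (1 ℕ.+ h ℕ.* 2)) m (inj₁ (odd-vanishes h))))
           (solve 1 (λ x → con 0ℤ :+ x :+ con 0ℤ := x) T.refl (v h * f h))) ⟩
    ∑ (suc D) (λ h → v h * f h)
      ≈⟨ ∑-head D (λ h → v h * f h) ⟩
    v 0 * f 0 + ∑ D (λ k → v (suc k) * f (suc k))
      ≈⟨ T.+-congʳ {x = ∑ D (λ k → v (suc k) * f (suc k))} (T.trans (T.*-congʳ {x = f 0} (T.-‿inverseʳ (w 0))) (T.zeroˡ (f 0))) ⟩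
    0ₛ + ∑ D (λ k → v (suc k) * f (suc k))
      ≈⟨ T.+-identityˡ (∑ D (λ k → v (suc k) * f (suc k))) ⟩
    ∑ D (λ k → v (suc k) * f (suc k)) ∎
    where
    m : ℕ
    m = j ℕ.+ l ℕ.* 6

    H : ℕ → Series
    H d = heckeSummand (m ℕ.+ d) m

  row₁ : ∀ l → row 1 l ≋ ∑ D (λ k → v (suc k) * (sgn (suc k) * q ^ exponent₁ l (suc k)))
  row₁ l = row-odd 1 l (λ h → sgn h * q ^ exponent₁ l h)
    (λ h → ≡.trans (≡.cong χ₋₄ (even l h)) (χ₋₄-even (1 ℕ.+ l ℕ.* 3 ℕ.+ h)))
    (λ h → T.trans (heckeSummand₁ l h) (T.*-assoc (v h) (sgn h) (q ^ exponent₁ l h)))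
    where
    even : ∀ l h → 1 ℕ.+ l ℕ.* 6 ℕ.+ (1 ℕ.+ h ℕ.* 2) ≡ (1 ℕ.+ l ℕ.* 3 ℕ.+ h) ℕ.* 2
    even = ℕSolver.solve-∀

  row₅ : ∀ l → row 5 l ≋ ∑ D (λ k → v (suc k) * (T.- sgn (suc k) * q ^ exponent₅ l (suc k)))
  row₅ l = row-odd 5 l (λ h → T.- sgn h * q ^ exponent₅ l h)
    (λ h → ≡.trans (≡.cong χ₋₄ (even l h)) (χ₋₄-even (3 ℕ.+ l ℕ.* 3 ℕ.+ h)))
    (λ h → T.trans (heckeSummand₅ l h) (T.*-assoc (v h) (T.- sgn h) (q ^ exponent₅ l h)))
    where
    even : ∀ l h → 5 ℕ.+ l ℕ.* 6 ℕ.+ (1 ℕ.+ h ℕ.* 2) ≡ (3 ℕ.+ l ℕ.* 3 ℕ.+ h) ℕ.* 2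
    even = ℕSolver.solve-∀

  -- Enlarging the triangle m ≤ n < D to a box adds only summands with n ≥ D, which vanish modulo
  -- q^K. The sides are multiples of 6 and 2, ready for splitting by residue and parity.
  hecke-box : ∑ D (λ n → ∑ (suc n) (heckeSummand n)) ≋ ∑ D (λ l → ∑ 6 (λ j → row j l))
  hecke-box = begin
    ∑ D (λ n → ∑ (suc n) (heckeSummand n))
      ≈⟨ ∑-triangle D heckeSummand ⟩
    ∑ D (λ m → ∑ (D ∸ m) (λ d → heckeSummand (m ℕ.+ d) m))
      ≈⟨ ∑-cong D (λ m _ → ∑-extend {f = λ d → heckeSummand (m ℕ.+ d) m}
           (ℕₚ.≤-trans (ℕₚ.m∸n≤m D m) (ℕₚ.≤-trans (ℕₚ.n≤1+n D) (ℕₚ.m≤m*n (suc D) 2)))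
           (λ d D∸m≤d → heckeSummand-large (m ℕ.+ d) m (ℕₚ.≤-trans (ℕₚ.m≤n+m∸n D m) (ℕₚ.+-monoʳ-≤ m D∸m≤d)) (ℕₚ.m≤m+n m d))) ⟨
    ∑ D (λ m → ∑ (suc D ℕ.* 2) (λ d → heckeSummand (m ℕ.+ d) m))
      ≈⟨ ∑-extend {f = λ m → ∑ (suc D ℕ.* 2) (λ d → heckeSummand (m ℕ.+ d) m)} (ℕₚ.m≤m*n D 6) (λ m D≤m →
           ∑-zero (suc D ℕ.* 2) λ d _ → heckeSummand-large (m ℕ.+ d) m (ℕₚ.≤-trans D≤m (ℕₚ.m≤m+n m d)) (ℕₚ.m≤m+n m d)) ⟨
    ∑ (D ℕ.* 6) (λ m → ∑ (suc D ℕ.* 2) (λ d → heckeSummand (m ℕ.+ d) m))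
      ≈⟨ ∑-blocks D 6 (λ m → ∑ (suc D ℕ.* 2) (λ d → heckeSummand (m ℕ.+ d) m)) ⟩
    ∑ D (λ l → ∑ 6 (λ j → row j l)) ∎

  hecke-side : ∑ D (λ n → ∑ (suc n) (heckeSummand n)) ≋ ∑ D (λ k → v (suc k) * T.- (sgn k * q ^ triangular k) * θ D k)
  hecke-side = begin
    ∑ D (λ n → ∑ (suc n) (heckeSummand n))
      ≈⟨ hecke-box ⟩
    ∑ D (λ l → ∑ 6 (λ j → row j l))
      ≈⟨ ∑-cong D (λ l _ → T.trans
           (T.+-cong (T.+-cong (T.+-cong (T.+-cong (T.+-cong (T.+-congˡ {x = 0ₛ}
             (row-zero 0 ≡.refl ≡.refl l)) (row₁ l)) (row-zero 2 ≡.refl ≡.refl l)) (row-zero 3 ≡.refl ≡.refl l))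
             (row-zero 4 ≡.refl ≡.refl l)) (row₅ l))
           (solve 2 (λ x y → con 0ℤ :+ con 0ℤ :+ x :+ con 0ℤ :+ con 0ℤ :+ con 0ℤ :+ y := x :+ y) T.refl
             (∑ D (F₁ l)) (∑ D (F₅ l)))) ⟩
    ∑ D (λ l → ∑ D (F₁ l) + ∑ D (F₅ l))
      ≈⟨ ∑-cong D (λ l _ → T.trans (T.sym (∑-+ D (F₁ l) (F₅ l))) (∑-cong D λ k _ → combine l k)) ⟩
    ∑ D (λ l → ∑ D (λ k → p k * (q ^ α l k - q ^ β l k)))
      ≈⟨ ∑-swap D D (λ l k → p k * (q ^ α l k - q ^ β l k)) ⟩
    ∑ D (λ k → ∑ D (λ l → p k * (q ^ α l k - q ^ β l k)))
      ≈⟨ ∑-cong D (λ k _ → ∑-*ˡ D (p k) (λ l → q ^ α l k - q ^ β l k)) ⟩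
    ∑ D (λ k → p k * θ D k) ∎
    where
    p : ℕ → Series
    p k = v (suc k) * T.- (sgn k * q ^ triangular k)

    F₁ F₅ : ℕ → ℕ → Series
    F₁ l k = v (suc k) * (sgn (suc k) * q ^ exponent₁ l (suc k))
    F₅ l k = v (suc k) * (T.- sgn (suc k) * q ^ exponent₅ l (suc k))

    q^exponent : ∀ {m n k} → m ≡ triangular k ℕ.+ n → q ^ m ≋ q ^ triangular k * q ^ n
    q^exponent {n = n} {k} ≡.refl = ^-homo-* q (triangular k) n

    combine : ∀ l k → F₁ l k + F₅ l k ≋ p k * (q ^ α l k - q ^ β l k)
    combine l k = T.trans
      (T.+-cong
        (T.*-congˡ {x = v (suc k)} (T.*-congˡ {x = sgn (suc k)} (q^exponent {k = k} (exponent₁-suc l k))))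
        (T.*-congˡ {x = v (suc k)} (T.*-congˡ {x = T.- sgn (suc k)} (q^exponent {k = k} (exponent₅-suc l k)))))
      (solve 5 (λ v s t a b → v :* (:- s :* (t :* a)) :+ v :* (:- :- s :* (t :* b)) := v :* :- (s :* t) :* (a :- b)) T.refl
        (v (suc k)) (sgn k) (q ^ triangular k) (q ^ α l k) (q ^ β l k))

  -- The convergence threshold that `hecke-summable` stores for `N` is literally `D`, so this
  -- coefficient of the limit unfolds to that of the `D`-th partial sum.
  hecke-sum≋ : ∑∞ (λ n → ∑< (suc n) (λ m → heckeSummand n m)) hecke-summable N
    L.≈ ∑ D (λ n → ∑ (suc n) (heckeSummand n)) N
  hecke-sum≋ = T.trans
    (T.reflexive (∑<≡∑ D (λ n → ∑< (suc n) (heckeSummand n))))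
    (∑-cong D λ n _ → T.reflexive (∑<≡∑ (suc n) (heckeSummand n))) .at N ℕₚ.≤-refl

theorem2p1 : ⟨ C (L.z^ 1ℤ) ⨾q⟩∞ * ⟨ C (L.z^ -1ℤ) ⨾q⟩∞ * ⟨ q^ 1 ⨾q⟩∞ * S
    ≈ ∑∞ (λ n → ∑< (suc n) (λ m → heckeSummand n m)) hecke-summable
theorem2p1 N = L.≈-trans
  (product-side .at N ℕₚ.≤-refl)
  (L.≈-sym (L.≈-trans hecke-sum≋ (hecke-side .at N ℕₚ.≤-refl)))
  where
  open Coefficient N
  open Truncated L.commutativeRing K using (at)
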